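{- Let $r \ge 2$ be an integer and $\ell \in \{1,\dots,r-1\}$. There exist positive constants $c_1$ and $c_2$ (depending only on $r$ and $\ell$) such that the following holds for every positive integer $n$ and every $r$-uniform hypergraph $G$ on at most $n$ vertices satisfying $\Delta_{\ell+1}(G) = 1$. (i) Any locally $\frac{c_1 n^{r-\ell}}{\Delta_1(G)\Delta_{\ell}(G)}$-bounded coloring of $K_n^{(r)}$ is $G$-proper. (ii) Any globally $\frac{c_2 n^{r-\ell}}{\Delta_1(G)\Delta_{\ell}(G)}$-bounded coloring of $K_n^{(r)}$ is $G$-rainbow.
   Context: $K_n^{(r)}$ is the complete $r$-uniform hypergraph on $n$ vertices. For a hypergraph $H$ and a set $S\subset V(H)$, the degree $d_H(S)$ is the number of edges of $H$ containing $S$; the maximum $j$-degree of $H$ is $\Delta_j(H) = \max\{d_H(S): S\subset V(H),\ |S| = j\}$. A coloring of $H$ is an arbitrary map $c: E(H)\to\mathbb{N}$. For a real number $k$, a coloring $c$ is locally $k$-bounded if each vertex is contained in at most $k$ edges of any given color, and globally $k$-bounded if each color is used on at most $k$ edges. A copy of $G$ in $H$ is a subhypergraph of $H$ isomorphic to $G$; it is properly colored if any two distinct edges of it with nonempty intersection receive different colors, and rainbow if all its edges receive pairwise different colors. A coloring of $H$ is $G$-proper (resp. $G$-rainbow) if it contains a properly colored (resp. rainbow) copy of $G$. -}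

module Defs where

open import Data.Bool using (Bool; T; T?)
open import Data.Fin using (Fin)
open import Data.Fin.Properties using (any?) renaming (_≟_ to _≟ᶠ_)
open import Data.Fin.Subset
  using (Subset; inside; outside; _∈_; _⊆_; _∩_; Nonempty; ∣_∣)
open import Data.Fin.Subset.Properties
  using (_∈?_; _⊆?_; out⊆; s⊆s; p⊆q⇒∣p∣≤∣q∣)
open import Data.Integer using (+_)
open import Data.List using (List; []; _∷_; _++_; map; filter; length; mapMaybe)
open import Data.List.Extrema.Nat using (max; xs≤max; argmax-sel)
open import Data.List.Membership.Propositional using () renaming (_∈_ to _∈ˡ_)
open import Data.List.Membership.Propositional.Properties
  using (∈-map⁺; ∈-map⁻; ∈-++⁺ˡ; ∈-++⁺ʳ; ∈-filter⁺; ∈-filter⁻)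
import Data.List.Relation.Unary.All as All
open import Data.List.Relation.Unary.Any using (here; there)
import Data.Maybe as Maybe
open import Data.Nat using (ℕ; zero; suc; _≤_; _<_; z≤n; s≤s; _≟_; _*_; NonZero; >-nonZero)
open import Data.Nat.Properties
  using (≤-trans; ≤-reflexive; n≤1+n; m*n≢0; <⇒≢)
open import Data.Product using (∃; _×_; _,_; proj₁; proj₂)
open import Data.Rational using (ℚ; _/_) renaming (_≤_ to _≤ℚ_)
open import Data.Sum using (inj₁; inj₂)
open import Data.Vec using ([]; _∷_; tabulate)
open import Function using (id; _⇔_)
open import Function.Definitions using (Injective)
open import Relation.Binary.PropositionalEquality
  using (_≡_; _≢_; refl; sym; cong; subst)
open import Relation.Nullary using (yes; no; does; contradiction)
open import Relation.Nullary.Decidable using (_×-dec_; ⌊_⌋; dec⇒maybe)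

private
  variable
    m n : ℕ

subsets : ∀ n → List (Subset n)
subsets zero    = [] ∷ []
subsets (suc n) = map (outside ∷_) (subsets n) ++ map (inside ∷_) (subsets n)

image : (Fin m → Fin n) → Subset m → Subset n
image φ S = tabulate λ v → does (any? λ u → (u ∈? S) ×-dec (φ u ≟ᶠ v))

-- The vertex set is Fin n. The edge set is a set of vertex sets, given by its
-- characteristic function, so there are no multiple edges.
record Hypergraph (n : ℕ) : Set where
  constructor hypergraph
  field
    isEdge : Subset n → Bool

open Hypergraph public

E : Hypergraph n → Set
E H = ∃ λ e → T (isEdge H e)

-- Enumerates every element of E H exactly once.
edges : (H : Hypergraph n) → List (E H)
edges {n} H =
  mapMaybe (λ e → Maybe.map (e ,_) (dec⇒maybe (T? (isEdge H e)))) (subsets n)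

Uniform : ℕ → Hypergraph n → Set
Uniform r H = ∀ e → T (isEdge H e) → ∣ e ∣ ≡ r

K : ∀ n r → Hypergraph n
K n r = hypergraph λ e → ⌊ ∣ e ∣ ≟ r ⌋

degree : Hypergraph n → Subset n → ℕ
degree H S = length (filter (λ e → S ⊆? proj₁ e) (edges H))

-- The value is 0 when j exceeds the number of vertices (empty maximum).
Δ : ℕ → Hypergraph n → ℕ
Δ {n} j H = max 0 (map (degree H) (filter (λ S → ∣ S ∣ ≟ j) (subsets n)))

Coloring : Hypergraph n → Set
Coloring H = E H → ℕ

LocallyBounded : (H : Hypergraph n) → ℚ → Coloring H → Set
LocallyBounded {n} H k c = ∀ (v : Fin n) (i : ℕ) →
  + length (filter (λ e → (v ∈? proj₁ e) ×-dec (c e ≟ i)) (edges H)) / 1 ≤ℚ k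

GloballyBounded : (H : Hypergraph n) → ℚ → Coloring H → Set
GloballyBounded H k c = ∀ (i : ℕ) →
  + length (filter (λ e → c e ≟ i) (edges H)) / 1 ≤ℚ k

record Subhypergraph (H : Hypergraph n) : Set where
  field
    vertices   : Subset n
    isSubEdge  : Subset n → Bool
    ⊆-vertices : ∀ e → T (isSubEdge e) → e ⊆ vertices
    ⊆-edges    : ∀ e → T (isSubEdge e) → T (isEdge H e)

  SubE : Set
  SubE = ∃ λ e → T (isSubEdge e)

  inclusion : SubE → E H
  inclusion (e , p) = e , ⊆-edges e p

-- A bijection φ from the vertices of G onto those of F under which a set is an
-- edge of G exactly when its image is an edge of F; every edge of F is such an
-- image because it lies inside the vertex set of F.
record _≅_ (G : Hypergraph m) {H : Hypergraph n} (F : Subhypergraph H) : Set where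
  open Subhypergraph F
  field
    φ          : Fin m → Fin n
    injective  : Injective _≡_ _≡_ φ
    onto       : ∀ v → v ∈ vertices ⇔ (∃ λ u → φ u ≡ v)
    edge⇔edge  : ∀ e → T (isEdge G e) ⇔ T (isSubEdge (image φ e))

ProperlyColored : {H : Hypergraph n} → Coloring H → Subhypergraph H → Set
ProperlyColored c F = ∀ (e f : SubE) → proj₁ e ≢ proj₁ f →
  Nonempty (proj₁ e ∩ proj₁ f) → c (inclusion e) ≢ c (inclusion f)
  where open Subhypergraph F

Rainbow : {H : Hypergraph n} → Coloring H → Subhypergraph H → Set
Rainbow c F = ∀ (e f : SubE) → proj₁ e ≢ proj₁ f →
  c (inclusion e) ≢ c (inclusion f)
  where open Subhypergraph F

_-proper_ : (G : Hypergraph m) {H : Hypergraph n} → Coloring H → Set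
G -proper c = ∃ λ F → G ≅ F × ProperlyColored c F

_-rainbow_ : (G : Hypergraph m) {H : Hypergraph n} → Coloring H → Set
G -rainbow c = ∃ λ F → G ≅ F × Rainbow c F

------------------------------------------------------------------------
-- If Δ (ℓ+1) G = 1 then G has an edge with more than ℓ vertices, so the
-- denominator Δ 1 G * Δ ℓ G is nonzero.

∈-subsets : (S : Subset n) → S ∈ˡ subsets n
∈-subsets []            = here refl
∈-subsets (outside ∷ S) = ∈-++⁺ˡ (∈-map⁺ _ (∈-subsets S))
∈-subsets (inside ∷ S)  = ∈-++⁺ʳ _ (∈-map⁺ _ (∈-subsets S))

∈-edges : (H : Hypergraph n) (e : Subset n) → T (isEdge H e) →
          ∃ λ p → (e , p) ∈ˡ edges H
∈-edges {n} H e t = go (subsets n) (∈-subsets e)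
  where
  go : ∀ xs → e ∈ˡ xs → ∃ λ p → (e , p) ∈ˡ
       mapMaybe (λ e → Maybe.map (e ,_) (dec⇒maybe (T? (isEdge H e)))) xs
  go (x ∷ xs) (here refl) with T? (isEdge H e)
  ... | yes p = p , here refl
  ... | no ¬p = contradiction t ¬p
  go (x ∷ xs) (there i) with T? (isEdge H x) | go xs i
  ... | yes _ | p , j = p , there j
  ... | no _  | p , j = p , j

shrink : ∀ {j} (S : Subset n) → j ≤ ∣ S ∣ → ∃ λ S′ → S′ ⊆ S × ∣ S′ ∣ ≡ j
shrink {j = zero}  []            _       = [] , id , refl
shrink             (outside ∷ S) j≤      with shrink S j≤
... | S′ , S′⊆S , eq = outside ∷ S′ , out⊆ S′⊆S , eq
shrink {j = zero}  (inside ∷ S)  _       with shrink S z≤n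
... | S′ , S′⊆S , eq = outside ∷ S′ , out⊆ S′⊆S , eq
shrink {j = suc j} (inside ∷ S)  (s≤s l) with shrink S l
... | S′ , S′⊆S , eq = inside ∷ S′ , s⊆s S′⊆S , cong suc eq

private
  ∈⇒length>0 : ∀ {A : Set} {x : A} {xs} → x ∈ˡ xs → 0 < length xs
  ∈⇒length>0 (here _)  = s≤s z≤n
  ∈⇒length>0 (there _) = s≤s z≤n

degree≤Δ : (H : Hypergraph n) (S : Subset n) → degree H S ≤ Δ ∣ S ∣ H
degree≤Δ H S = All.lookup (xs≤max 0 _)
  (∈-map⁺ (degree H) (∈-filter⁺ (λ S′ → ∣ S′ ∣ ≟ ∣ S ∣) (∈-subsets S) refl))

Δ>0⇒edge : ∀ {j} (H : Hypergraph n) → 0 < Δ j H →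
           ∃ λ e → T (isEdge H e) × j ≤ ∣ e ∣
Δ>0⇒edge {n} {j} H Δ>0
  with argmax-sel id 0 (map (degree H) (filter (λ S → ∣ S ∣ ≟ j) (subsets n)))
... | inj₁ eq = contradiction (sym eq) (<⇒≢ Δ>0)
... | inj₂ i with ∈-map⁻ (degree H) i
... | S , S∈ , eq
  with filter (λ e → S ⊆? proj₁ e) (edges H) in eq′
... | [] = contradiction (sym eq) (<⇒≢ Δ>0)
... | (e , t) ∷ _ = e , t , subst (_≤ ∣ e ∣)
  (proj₂ (∈-filter⁻ (λ S → ∣ S ∣ ≟ j) {xs = subsets n} S∈))
  (p⊆q⇒∣p∣≤∣q∣ (proj₂ (∈-filter⁻ (λ e → S ⊆? proj₁ e) {xs = edges H}
    (subst ((e , t) ∈ˡ_) (sym eq′) (here refl)))))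

edge⇒Δ>0 : ∀ {j} (H : Hypergraph n) (e : Subset n) → T (isEdge H e) →
           j ≤ ∣ e ∣ → 0 < Δ j H
edge⇒Δ>0 H e t j≤ with shrink e j≤
... | S , S⊆e , refl = ≤-trans
  (∈⇒length>0 (∈-filter⁺ (λ e → S ⊆? proj₁ e) (proj₂ (∈-edges H e t)) S⊆e))
  (degree≤Δ H S)

ΔΔ-nonZero : ∀ {ℓ} (H : Hypergraph n) → Δ (suc ℓ) H ≡ 1 →
             NonZero (Δ 1 H * Δ ℓ H)
ΔΔ-nonZero {ℓ = ℓ} H Δ≡1 with Δ>0⇒edge H (≤-reflexive (sym Δ≡1))
... | e , t , l = m*n≢0 (Δ 1 H) (Δ ℓ H)
  {{>-nonZero (edge⇒Δ>0 H e t (≤-trans (s≤s z≤n) l))}}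
  {{>-nonZero (edge⇒Δ>0 H e t (≤-trans (n≤1+n ℓ) l))}}

{-# OPTIONS --safe #-}
module Submission where

-- A uniformly random injection φ of the vertices of G into those of K n r is analysed with the
-- Lovász local lemma in the form of Lu and Székely. A bad event prescribes the values of φ on the
-- union of two edges of G so that their images get the same colour; two events conflict if they
-- share a vertex of G or a vertex of K n r. Composing φ with transpositions shows that avoiding
-- events that do not conflict with A does not make A more likely. Two edges of G meet in some
-- j ≤ ℓ vertices; ordering the common vertices first, the pairs of edges and the equally coloured
-- pairs of targets are counted by extending vectors, and since n ^ j * Δ j G is at most of order
-- n ^ ℓ * Δ ℓ G, every j contributes the same order to the total probability of the events
-- conflicting with a given one. For a local bound only j ≥ 1 occurs, and the second target
-- edge is one of the k edges of the given colour through a common vertex; for a global bound j = 0 is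
-- allowed as well.

open import Defs
open import Data.Bool using (if_then_else_; T; T?)
import Data.Bool.Properties as Bool
open import Data.Bool.Properties using (T-irrelevant)
open import Data.Fin using (Fin; zero; suc; inject≤)
open import Data.Fin.Permutation.Components using (transpose; transpose-inverse)
open import Data.Fin.Properties using (_≟_; all?; any?; suc-injective; inject≤-injective)
open import Data.Fin.Subset
  using (Subset; inside; outside; _⊆_; _∩_; _∪_; ∁; ⊤; ⊥; ⁅_⁆; Nonempty; ∣_∣)
  renaming (_∈_ to _∈ˢ_; _∉_ to _∉ˢ_)
open import Data.Fin.Subset.Properties
  using ( x∈⁅x⁆; x∈⁅y⁆⇒x≡y; ∣⁅x⁆∣≡1; ∣⊥∣≡0; ∉⊥; ∈⊤; x∈p∪q⁻; x∈p∪q⁺; x∈p∩q⁺; x∈p∩q⁻; ⊆-antisym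
        ; x∉p⇒x∈∁p; x∈∁p⇒x∉p; ∪-identityˡ; ∪-assoc; _⊆?_; p⊆q⇒∣p∣≤∣q∣; p∩q⊆p; p∩q⊆q)
  renaming (_∈?_ to _∈ˢ?_)
import Data.Integer as ℤ
import Data.Integer.Properties as ℤ
open import Data.List
  using ( List; []; _∷_; _++_; map; filter; length; allFin; upTo; zip; concatMap
        ; cartesianProduct; cartesianProductWith)
open import Data.List.Properties
  using ( filter-notAll; length-tabulate; length-map; length-++; length-upTo; length-zipWith
        ; map-tabulate; map-++; ++-assoc)
import Data.List.Membership.DecPropositional as DecMembership
open import Data.List.Membership.Propositional using (_∈_; _∉_; find; lose)
open import Data.List.Membership.Propositional.Properties
  using ( ∈-map⁺; ∈-map⁻; ∈-filter⁺; ∈-filter⁻; ∈-++⁺ˡ; ∈-++⁺ʳ; ∈-++⁻; ∈-allFin; ∈-upTo⁺; ∈-upTo⁻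
        ; ∈-concatMap⁺; ∈-concatMap⁻; ∈-cartesianProduct⁺
        ; ∈-cartesianProductWith⁺; ∈-cartesianProductWith⁻)
open import Data.List.Relation.Unary.All as All using (All; []; _∷_)
open import Data.List.Relation.Unary.All.Properties
  using (¬Any⇒All¬; All¬⇒¬Any; all-filter; filter⁺)
open import Data.List.Relation.Unary.AllPairs using ([]; _∷_)
open import Data.List.Relation.Unary.Any as Any using (Any; here; there)
open import Data.List.Relation.Unary.Unique.DecPropositional using (unique?)
open import Data.List.Relation.Unary.Unique.Propositional using (Unique)
import Data.List.Relation.Unary.Unique.Propositional.Properties as Unique
open import Data.Nat as ℕ hiding (_≟_; _/_)
open import Data.Nat.DivMod using (m*n/n≡m; m/n*n≤m; /-monoˡ-≤)
open import Data.Nat.Induction using (<-wellFounded)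
open import Data.Nat.Properties hiding (_≟_; suc-injective)
open import Data.Nat.Solver using (module +-*-Solver)
open import Data.Product using (∃; _×_; _,_; proj₁; proj₂; map₂) renaming (swap to ×-swap)
open import Data.Rational
  using (ℚ; 0ℚ; _/_; toℚᵘ) renaming (_<_ to _<ℚ_; _≤_ to _≤ℚ_; _*_ to _*ℚ_)
open import Data.Rational.Properties
  using (toℚᵘ-mono-≤; toℚᵘ-homo-*; toℚᵘ-fromℚᵘ; positive⁻¹; normalize-pos)
open import Data.Rational.Unnormalised as ℚᵘ using (mkℚᵘ; *≤*)
import Data.Rational.Unnormalised.Properties as ℚᵘ
open import Data.Sum as Sum using (_⊎_; inj₁; inj₂)
open import Data.Vec as Vec using (Vec; []; _∷_; here; there; lookup; toList; fromList)
open import Data.Vec.Properties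
  using ( ≡-dec; lookup-map; map-∘; map-cong; map-id; ∷-injective; length-toList; toList-map
        ; toList∘fromList; lookup∘tabulate; []=⇒lookup; lookup⇒[]=)
open import Function using (_∘_; id; case_of_; mk⇔)
open import Induction.WellFounded using (Acc; acc)
import Relation.Binary as B
open import Relation.Binary.PropositionalEquality
open import Relation.Nullary
open import Relation.Nullary.Decidable
  using (_×-dec_; _⊎-dec_; _→-dec_; ¬?; ⌊_⌋; dec-true; dec-false; toWitness; fromWitness)
open import Relation.Unary using (Decidable)

-- Finite sums and indicators

-- The threshold comes from one exponent count. Constants in r aside, a pair of edges meeting in j
-- vertices fixes 2r - j values of φ, so a given bad event has probability about n^-(2r-j). At most
-- Δ_1 Δ_ℓ n^(ℓ-j) such pairs use a given vertex of G, and about n^r k pairs of targets are equally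
-- coloured. The product is Δ_1 Δ_ℓ k / n^(r-ℓ), in which j has cancelled; conflicts at a vertex of
-- the host give the same order. Hence k may be a small multiple of n^(r-ℓ) / (Δ_1 Δ_ℓ). The
-- condition Δ_(ℓ+1) = 1 is what confines j to at most ℓ.
--
-- The obstacle is that the values of an injection are never independent, so disjoint events are
-- still correlated; the local lemma only needs the correlation bounded in one direction.
-- Probabilities are replaced by counts and every inequality is multiplied out in ℕ, so that
-- conditioning on an empty set of outcomes needs no special case. Edges are counted as ordered
-- tuples, which turns the counts into iterated sums over vectors at the price of factors r^r.

private
  variable
    X Y Z : Set
    P Q S : Set

∑ : List X → (X → ℕ) → ℕ
∑ []       f = 0
∑ (x ∷ xs) f = f x + ∑ xs f

𝟙 : Dec P → ℕ
𝟙 p? = if does p? then 1 else 0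

𝟙-yes : (p? : Dec P) → P → 𝟙 p? ≡ 1
𝟙-yes (yes _) _ = refl
𝟙-yes (no ¬p) p = contradiction p ¬p

𝟙≤1 : (p? : Dec P) → 𝟙 p? ≤ 1
𝟙≤1 (yes _) = s≤s z≤n
𝟙≤1 (no _)  = z≤n

𝟙-elim : (p? : Dec P) {k : ℕ} → (P → 1 ≤ k) → 𝟙 p? ≤ k
𝟙-elim (yes p) 1≤k = 1≤k p
𝟙-elim (no _)  _   = z≤n

𝟙-mono : (p? : Dec P) (q? : Dec Q) → (P → Q) → 𝟙 p? ≤ 𝟙 q?
𝟙-mono p? q? p⇒q = 𝟙-elim p? (≤-reflexive ∘ sym ∘ 𝟙-yes q? ∘ p⇒q)

𝟙-cong : (p? : Dec P) (q? : Dec Q) → (P → Q) → (Q → P) → 𝟙 p? ≡ 𝟙 q?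
𝟙-cong p? q? p⇒q q⇒p = ≤-antisym (𝟙-mono p? q? p⇒q) (𝟙-mono q? p? q⇒p)

𝟙-× : (p? : Dec P) (q? : Dec Q) → 𝟙 (p? ×-dec q?) ≡ 𝟙 p? * 𝟙 q?
𝟙-× (yes _) (yes _) = refl
𝟙-× (yes _) (no _)  = refl
𝟙-× (no _)  (yes _) = refl
𝟙-× (no _)  (no _)  = refl

𝟙-⊎ : (p? : Dec P) (q? : Dec Q) (s? : Dec S) → (P → Q ⊎ S) → 𝟙 p? ≤ 𝟙 q? + 𝟙 s?
𝟙-⊎ p? q? s? split = 𝟙-elim p? λ p → case split p of λ where
  (inj₁ q) → subst (_≤ 𝟙 q? + 𝟙 s?) (𝟙-yes q? q) (m≤m+n _ _)
  (inj₂ s) → subst (_≤ 𝟙 q? + 𝟙 s?) (𝟙-yes s? s) (m≤n+m _ _)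

∑-mono-∈ : (xs : List X) {f g : X → ℕ} → (∀ {x} → x ∈ xs → f x ≤ g x) → ∑ xs f ≤ ∑ xs g
∑-mono-∈ []       f≤g = z≤n
∑-mono-∈ (x ∷ xs) f≤g = +-mono-≤ (f≤g (here refl)) (∑-mono-∈ xs (f≤g ∘ there))

∑-mono : (xs : List X) {f g : X → ℕ} → (∀ x → f x ≤ g x) → ∑ xs f ≤ ∑ xs g
∑-mono xs f≤g = ∑-mono-∈ xs λ _ → f≤g _

∑-cong : (xs : List X) {f g : X → ℕ} → (∀ x → f x ≡ g x) → ∑ xs f ≡ ∑ xs g
∑-cong []       f≡g = refl
∑-cong (x ∷ xs) f≡g = cong₂ _+_ (f≡g x) (∑-cong xs f≡g)

∑-+ : (xs : List X) (f g : X → ℕ) → ∑ xs (λ x → f x + g x) ≡ ∑ xs f + ∑ xs g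
∑-+ []       f g = refl
∑-+ (x ∷ xs) f g rewrite ∑-+ xs f g =
  solve 4 (λ a b c d → (a :+ b) :+ (c :+ d) := (a :+ c) :+ (b :+ d)) refl
    (f x) (g x) (∑ xs f) (∑ xs g)
  where open +-*-Solver

∑-*ˡ : (xs : List X) (k : ℕ) (f : X → ℕ) → ∑ xs (λ x → k * f x) ≡ k * ∑ xs f
∑-*ˡ []       k f = sym (*-zeroʳ k)
∑-*ˡ (x ∷ xs) k f rewrite ∑-*ˡ xs k f = sym (*-distribˡ-+ k (f x) (∑ xs f))

∑-*ʳ : (xs : List X) (f : X → ℕ) (k : ℕ) → ∑ xs (λ x → f x * k) ≡ ∑ xs f * k
∑-*ʳ xs f k = trans (∑-cong xs λ x → *-comm (f x) k)
  (trans (∑-*ˡ xs k f) (*-comm k (∑ xs f)))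

∑-const : (xs : List X) (k : ℕ) → ∑ xs (λ _ → k) ≡ length xs * k
∑-const []       k = refl
∑-const (x ∷ xs) k = cong (k +_) (∑-const xs k)

∑-bound : (xs : List X) {f : X → ℕ} {k : ℕ} → (∀ {x} → x ∈ xs → f x ≤ k) → ∑ xs f ≤ length xs * k
∑-bound xs f≤k = ≤-trans (∑-mono-∈ xs f≤k) (≤-reflexive (∑-const xs _))

∑-swap : (xs : List X) (ys : List Y) (f : X → Y → ℕ) →
         ∑ xs (λ x → ∑ ys (f x)) ≡ ∑ ys (λ y → ∑ xs (λ x → f x y))
∑-swap []       ys f = sym (trans (∑-const ys 0) (*-zeroʳ (length ys)))
∑-swap (x ∷ xs) ys f = trans (cong (∑ ys (f x) +_) (∑-swap xs ys f))
  (sym (∑-+ ys (f x) (λ y → ∑ xs λ x → f x y)))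

∑-++ : (xs ys : List X) (f : X → ℕ) → ∑ (xs ++ ys) f ≡ ∑ xs f + ∑ ys f
∑-++ []       ys f = refl
∑-++ (x ∷ xs) ys f = trans (cong (f x +_) (∑-++ xs ys f)) (sym (+-assoc (f x) _ _))

∑-map : (h : X → Y) (xs : List X) (f : Y → ℕ) → ∑ (map h xs) f ≡ ∑ xs (f ∘ h)
∑-map h []       f = refl
∑-map h (x ∷ xs) f = cong (f (h x) +_) (∑-map h xs f)

∑-concatMap : (h : X → List Y) (xs : List X) (f : Y → ℕ) →
              ∑ (concatMap h xs) f ≡ ∑ xs (λ x → ∑ (h x) f)
∑-concatMap h []       f = refl
∑-concatMap h (x ∷ xs) f = trans (∑-++ (h x) _ f) (cong (∑ (h x) f +_) (∑-concatMap h xs f))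

∑-product : (h : X → Y → Z) (xs : List X) (ys : List Y) (f : Z → ℕ) →
            ∑ (cartesianProductWith h xs ys) f ≡ ∑ xs (λ x → ∑ ys (λ y → f (h x y)))
∑-product h []       ys f = refl
∑-product h (x ∷ xs) ys f = trans (∑-++ (map (h x) ys) _ f)
  (cong₂ _+_ (∑-map (h x) ys f) (∑-product h xs ys f))

∑-filter : {P : X → Set} (P? : Decidable P) (xs : List X) (f : X → ℕ) →
           ∑ (filter P? xs) f ≡ ∑ xs (λ x → 𝟙 (P? x) * f x)
∑-filter P? []       f = refl
∑-filter P? (x ∷ xs) f with P? x
... | yes _ = cong₂ _+_ (sym (*-identityˡ (f x))) (∑-filter P? xs f)
... | no  _ = ∑-filter P? xs f

∑-∈ : {x : X} {xs : List X} (f : X → ℕ) → x ∈ xs → f x ≤ ∑ xs f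
∑-∈ f (here refl) = m≤m+n _ _
∑-∈ f (there x∈)  = ≤-trans (∑-∈ f x∈) (m≤n+m _ _)

∑>0⇒∃ : (xs : List X) {P : X → Set} (P? : Decidable P) → 0 < ∑ xs (λ x → 𝟙 (P? x)) → ∃ λ x → x ∈ xs × P x
∑>0⇒∃ (x ∷ xs) P? 0< with P? x
... | yes p = x , here refl , p
... | no  _ = case ∑>0⇒∃ xs P? 0< of λ where (y , y∈ , p) → y , there y∈ , p

𝟙-any : {P : X → Set} (P? : Decidable P) (xs : List X) → 𝟙 (Any.any? P? xs) ≤ ∑ xs (λ x → 𝟙 (P? x))
𝟙-any P? xs = 𝟙-elim (Any.any? P? xs) go
  where
  go : ∀ {xs} → Any _ xs → 1 ≤ ∑ xs (λ x → 𝟙 (P? x))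
  go {x ∷ xs} (here p)  = ≤-trans (≤-reflexive (sym (𝟙-yes (P? x) p))) (m≤m+n _ _)
  go {x ∷ xs} (there i) = ≤-trans (go i) (m≤n+m _ _)

-- The local lemma, counting outcomes

module Avoidance {X Ev : Set} (Ω : List X) {_⊨_ : X → Ev → Set} (_⊨?_ : B.Decidable _⊨_) where

  Avoids : List Ev → X → Set
  Avoids S φ = All (λ A → ¬ φ ⊨ A) S

  avoids? : ∀ S φ → Dec (Avoids S φ)
  avoids? S φ = All.all? (λ A → ¬? (φ ⊨? A)) S

  #avoiding : List Ev → ℕ
  #avoiding S = ∑ Ω λ φ → 𝟙 (avoids? S φ)

  #avoidingIn : Ev → List Ev → ℕ
  #avoidingIn A S = ∑ Ω λ φ → 𝟙 ((φ ⊨? A) ×-dec avoids? S φ)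

  #avoidingIn-mono : ∀ A {S T} → (∀ {φ} → Avoids S φ → Avoids T φ) → #avoidingIn A S ≤ #avoidingIn A T
  #avoidingIn-mono A S⇒T = ∑-mono Ω λ φ → 𝟙-mono ((φ ⊨? A) ×-dec avoids? _ φ) ((φ ⊨? A) ×-dec avoids? _ φ) (map₂ S⇒T)

  #avoiding-∷ : ∀ A S → #avoiding S ≤ #avoiding (A ∷ S) + #avoidingIn A S
  #avoiding-∷ A S = ≤-trans
    (∑-mono Ω λ φ → 𝟙-⊎ (avoids? S φ) (avoids? (A ∷ S) φ) ((φ ⊨? A) ×-dec avoids? S φ) (split φ))
    (≤-reflexive (∑-+ Ω _ _))
    where
    split : ∀ φ → Avoids S φ → Avoids (A ∷ S) φ ⊎ (φ ⊨ A × Avoids S φ)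
    split φ avoids with φ ⊨? A
    ... | yes A-holds = inj₂ (A-holds , avoids)
    ... | no ¬A-holds = inj₁ (¬A-holds ∷ avoids)

  -- w A / M is an upper bound for the probability of A. With the conflicting weights adding up to
  -- at most M / 4, conditioning on avoiding other events at most doubles it.
  module LocalLemma
    {_~_ : Ev → Ev → Set} (_~?_ : B.Decidable _~_) (w : Ev → ℕ) (M : ℕ) .{{_ : NonZero M}}
    {Valid : Ev → Set} (valid⇒~ : ∀ {A} → Valid A → A ~ A)
    (negDependence : ∀ A S → Valid A → All (λ B → ¬ A ~ B) S → M * #avoidingIn A S ≤ w A * #avoiding S)
    where

    -- Tested on valid events only: an event with unboundedly many pairs could conflict with
    -- unboundedly much weight.
    Sparse : List Ev → Set
    Sparse S = ∀ A → Valid A → 4 * ∑ S (λ B → 𝟙 (A ~? B) * w B) ≤ M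

    sparse-filter : {P : Ev → Set} (P? : Decidable P) (S : List Ev) → Sparse S → Sparse (filter P? S)
    sparse-filter P? S sparse A validA = ≤-trans (*-monoʳ-≤ 4 (≤-trans
      (≤-reflexive (∑-filter P? S _))
      (∑-mono S λ B → ≤-trans (*-monoˡ-≤ _ (𝟙≤1 (P? B))) (≤-reflexive (*-identityˡ _))))) (sparse A validA)

    module Split (A : Ev) (S : List Ev) where
      near far : List Ev
      near = filter (A ~?_) S
      far  = filter (λ B → ¬? (A ~? B)) S

      avoids-far : ∀ {φ} → Avoids S φ → Avoids far φ
      avoids-far avoids = filter⁺ _ avoids

      -- An outcome that avoids `far` but not all of `S` must satisfy some event of `near`.
      union-bound : #avoiding far ≤ #avoiding S + ∑ near (λ B → #avoidingIn B far)
      union-bound = begin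
        #avoiding far
          ≤⟨ ∑-mono Ω pointwise ⟩
        ∑ Ω (λ φ → 𝟙 (avoids? S φ) + ∑ near (λ B → 𝟙 ((φ ⊨? B) ×-dec avoids? far φ)))
          ≡⟨ ∑-+ Ω _ _ ⟩
        #avoiding S + ∑ Ω (λ φ → ∑ near (λ B → 𝟙 ((φ ⊨? B) ×-dec avoids? far φ)))
          ≡⟨ cong (#avoiding S +_) (∑-swap Ω near _) ⟩
        #avoiding S + ∑ near (λ B → #avoidingIn B far) ∎
        where
        open ≤-Reasoning
        pointwise : ∀ φ → 𝟙 (avoids? far φ) ≤
          𝟙 (avoids? S φ) + ∑ near (λ B → 𝟙 ((φ ⊨? B) ×-dec avoids? far φ))
        pointwise φ with avoids? far φ | Any.any? (φ ⊨?_) near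
        ... | no _  | _ = z≤n
        ... | yes avoidsFar | yes hit with B , B∈near , hits ← find hit = ≤-trans
          (≤-reflexive (sym (𝟙-yes ((φ ⊨? B) ×-dec yes avoidsFar) (hits , avoidsFar))))
          (≤-trans (∑-∈ (λ B → 𝟙 ((φ ⊨? B) ×-dec yes avoidsFar)) B∈near) (m≤n+m _ _))
        ... | yes avoidsFar | no miss = ≤-trans (≤-reflexive (sym (𝟙-yes (avoids? S φ) (All.tabulate avoid)))) (m≤m+n _ _)
          where
          avoid : ∀ {B} → B ∈ S → ¬ φ ⊨ B
          avoid {B} B∈S with A ~? B
          ... | yes A~B = All.lookup (¬Any⇒All¬ near miss) (∈-filter⁺ (A ~?_) B∈S A~B)
          ... | no  A≁B = All.lookup avoidsFar (∈-filter⁺ (λ B → ¬? (A ~? B)) B∈S A≁B)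

    -- Induction on the length of `S`. Forgetting `near` in the count for `A` costs nothing and
    -- makes negative dependence applicable. The price is paid on the other side: by the induction
    -- hypothesis the events of `near` together remove at most half of the outcomes avoiding `far`,
    -- which is the factor 2.
    conditional : ∀ S → Acc _<_ (length S) → All Valid S → Sparse S → ∀ A → Valid A →
                  M * #avoidingIn A S ≤ 2 * w A * #avoiding S
    conditional S (acc rec) validS sparse A validA = begin
      M * #avoidingIn A S      ≤⟨ *-monoʳ-≤ M (#avoidingIn-mono A avoids-far) ⟩
      M * #avoidingIn A far    ≤⟨ negDependence A far validA (all-filter _ S) ⟩
      w A * #avoiding far      ≤⟨ *-monoʳ-≤ (w A) half ⟩
      w A * (2 * #avoiding S)
        ≡⟨ solve 2 (λ a b → a :* (con 2 :* b) := con 2 :* a :* b) refl (w A) (#avoiding S) ⟩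
      2 * w A * #avoiding S    ∎
      where
      open ≤-Reasoning
      open Split A S
      open +-*-Solver
      IH : ∀ {B} → B ∈ near → M * #avoidingIn B far ≤ 2 * w B * #avoiding far
      -- `far` lacks `B`, hence is strictly shorter than `S`; if `near` is empty, the induction
      -- hypothesis is never called.
      IH {B} B∈near = conditional far
        (rec (filter-notAll _ S (Any.map (λ where refl ¬A~B → ¬A~B A~B) B∈S)))
        (filter⁺ _ validS) (sparse-filter _ S sparse) B (All.lookup validS B∈S)
        where
        B∈S = proj₁ (∈-filter⁻ (A ~?_) B∈near)
        A~B = proj₂ (∈-filter⁻ (A ~?_) {xs = S} B∈near)
      W : ℕ
      W = ∑ near w
      4W≤M : 4 * W ≤ M
      4W≤M = subst (λ k → 4 * k ≤ M) (sym (∑-filter (A ~?_) S w)) (sparse A validA)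
      near-bound : M * ∑ near (λ B → #avoidingIn B far) ≤ 2 * W * #avoiding far
      near-bound = begin
        M * ∑ near (λ B → #avoidingIn B far)    ≡⟨ sym (∑-*ˡ near M _) ⟩
        ∑ near (λ B → M * #avoidingIn B far)    ≤⟨ ∑-mono-∈ near IH ⟩
        ∑ near (λ B → 2 * w B * #avoiding far)  ≡⟨ ∑-*ʳ near (λ B → 2 * w B) _ ⟩
        ∑ near (λ B → 2 * w B) * #avoiding far  ≡⟨ cong (_* #avoiding far) (∑-*ˡ near 2 w) ⟩
        2 * W * #avoiding far                   ∎
      half : #avoiding far ≤ 2 * #avoiding S
      -- Adding `M * #avoiding far` to both sides avoids a subtraction; the union bound then loses
      -- at most `4 * W * #avoiding far`, which the added term covers.
      half = *-cancelˡ-≤ M (+-cancelʳ-≤ (M * #avoiding far) _ _ (begin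
        M * #avoiding far + M * #avoiding far
          ≡⟨ solve 2 (λ a b → a :* b :+ a :* b := con 2 :* a :* b) refl M (#avoiding far) ⟩
        2 * M * #avoiding far
          ≤⟨ *-monoʳ-≤ (2 * M) union-bound ⟩
        2 * M * (#avoiding S + ∑ near (λ B → #avoidingIn B far))
          ≡⟨ solve 3 (λ a b c → con 2 :* a :* (b :+ c) := a :* (con 2 :* b) :+ con 2 :* (a :* c)) refl M (#avoiding S) _ ⟩
        M * (2 * #avoiding S) + 2 * (M * ∑ near (λ B → #avoidingIn B far))
          ≤⟨ +-monoʳ-≤ (M * (2 * #avoiding S)) (*-monoʳ-≤ 2 near-bound) ⟩
        M * (2 * #avoiding S) + 2 * (2 * W * #avoiding far)
          ≡⟨ cong (M * (2 * #avoiding S) +_)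
               (solve 2 (λ a b → con 2 :* (con 2 :* a :* b) := con 4 :* a :* b) refl W (#avoiding far)) ⟩
        M * (2 * #avoiding S) + 4 * W * #avoiding far
          ≤⟨ +-monoʳ-≤ (M * (2 * #avoiding S)) (*-monoˡ-≤ (#avoiding far) 4W≤M) ⟩
        M * (2 * #avoiding S) + M * #avoiding far ∎))

    -- Every event conflicts with itself, so sparsity bounds its own weight.
    avoidable : ∀ S → All Valid S → Sparse S → 0 < #avoiding [] → 0 < #avoiding S
    avoidable []      _                 _      0<Ω = 0<Ω
    avoidable (A ∷ S) (validA ∷ validS) sparse 0<Ω = positive
      where
      open ≤-Reasoning
      open +-*-Solver
      sparseS : Sparse S
      sparseS B validB = ≤-trans (*-monoʳ-≤ 4 (m≤n+m (∑ S λ C → 𝟙 (B ~? C) * w C) (𝟙 (B ~? A) * w A))) (sparse B validB)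
      4w≤M : 4 * w A ≤ M
      4w≤M = ≤-trans (*-monoʳ-≤ 4 (begin
        w A                                  ≡⟨ sym (*-identityˡ (w A)) ⟩
        1 * w A
          ≡⟨ cong (_* w A) (sym (𝟙-yes (A ~? A) (valid⇒~ validA))) ⟩
        𝟙 (A ~? A) * w A                     ≤⟨ m≤m+n _ _ ⟩
        ∑ (A ∷ S) (λ B → 𝟙 (A ~? B) * w B)   ∎)) (sparse A validA)
      2In≤ : 2 * #avoidingIn A S ≤ #avoiding S
      2In≤ = *-cancelˡ-≤ M (begin
        M * (2 * #avoidingIn A S)
          ≡⟨ solve 2 (λ a b → a :* (con 2 :* b) := con 2 :* (a :* b)) refl M (#avoidingIn A S) ⟩
        2 * (M * #avoidingIn A S)
          ≤⟨ *-monoʳ-≤ 2 (conditional S (<-wellFounded _) validS sparseS A validA) ⟩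
        2 * (2 * w A * #avoiding S)
          ≡⟨ solve 2 (λ a b → con 2 :* (con 2 :* a :* b) := con 4 :* a :* b) refl (w A) (#avoiding S) ⟩
        4 * w A * #avoiding S        ≤⟨ *-monoˡ-≤ (#avoiding S) 4w≤M ⟩
        M * #avoiding S              ∎)
      positive : 0 < #avoiding (A ∷ S)
      positive with #avoiding (A ∷ S) in eq
      ... | suc _ = s≤s z≤n
      -- If nothing avoided `A` as well, every outcome avoiding `S` would satisfy `A`, whereas at
      -- most half of them do.
      ... | zero  = contradiction (begin-strict
        #avoiding S               <⟨ m<m+n _ (avoidable S validS sparseS 0<Ω) ⟩
        #avoiding S + #avoiding S ≤⟨ +-mono-≤ le le ⟩
        #avoidingIn A S + #avoidingIn A S
          ≡⟨ solve 1 (λ a → a :+ a := con 2 :* a) refl (#avoidingIn A S) ⟩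
        2 * #avoidingIn A S       ≤⟨ 2In≤ ⟩
        #avoiding S               ∎) (<-irrefl refl)
        where
        le : #avoiding S ≤ #avoidingIn A S
        le = subst (λ k → #avoiding S ≤ k + #avoidingIn A S) eq (#avoiding-∷ A S)

-- Random injections

-- "Exactly once" is phrased as a sum so that reindexing becomes double counting, without
-- permutations of lists.
Enumerates : B.DecidableEquality X → List X → Set
Enumerates _≟_ xs = ∀ a → ∑ xs (λ x → 𝟙 (x ≟ a)) ≡ 1

∑-pick : (_≟_ : B.DecidableEquality X) (xs : List X) → Enumerates _≟_ xs →
         ∀ a (f : X → ℕ) → ∑ xs (λ x → 𝟙 (x ≟ a) * f x) ≡ f a
∑-pick _≟_ xs enum a f = begin
  ∑ xs (λ x → 𝟙 (x ≟ a) * f x)  ≡⟨ ∑-cong xs same ⟩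
  ∑ xs (λ x → 𝟙 (x ≟ a) * f a)  ≡⟨ ∑-*ʳ xs _ (f a) ⟩
  ∑ xs (λ x → 𝟙 (x ≟ a)) * f a  ≡⟨ cong (_* f a) (enum a) ⟩
  1 * f a                       ≡⟨ *-identityˡ (f a) ⟩
  f a                           ∎
  where
  open ≡-Reasoning
  same : ∀ x → 𝟙 (x ≟ a) * f x ≡ 𝟙 (x ≟ a) * f a
  same x with x ≟ a
  ... | yes refl = refl
  ... | no _     = refl

-- Expand `f (τ x)` as a sum over all y with the indicator of y = τ x and exchange the sums; for an
-- involution that indicator equals the one of x = τ y, and each y is hit once.
∑-involution : (_≟_ : B.DecidableEquality X) (xs : List X) → Enumerates _≟_ xs →
               (τ : X → X) → (∀ x → τ (τ x) ≡ x) → (f : X → ℕ) → ∑ xs (f ∘ τ) ≡ ∑ xs f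
∑-involution _≟_ xs enum τ ττ f = begin
  ∑ xs (f ∘ τ)
    ≡⟨ ∑-cong xs (λ x → sym (∑-pick _≟_ xs enum (τ x) f)) ⟩
  ∑ xs (λ x → ∑ xs (λ y → 𝟙 (y ≟ τ x) * f y))   ≡⟨ ∑-swap xs xs _ ⟩
  ∑ xs (λ y → ∑ xs (λ x → 𝟙 (y ≟ τ x) * f y))   ≡⟨ ∑-cong xs (λ y → ∑-*ʳ xs _ (f y)) ⟩
  ∑ xs (λ y → ∑ xs (λ x → 𝟙 (y ≟ τ x)) * f y)
    ≡⟨ ∑-cong xs (λ y → cong (_* f y) (∑-cong xs (transfer y))) ⟩
  ∑ xs (λ y → ∑ xs (λ x → 𝟙 (x ≟ τ y)) * f y)   ≡⟨ ∑-cong xs (λ y → cong (_* f y) (enum (τ y))) ⟩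
  ∑ xs (λ y → 1 * f y)                          ≡⟨ ∑-cong xs (λ y → *-identityˡ (f y)) ⟩
  ∑ xs f                                        ∎
  where
  open ≡-Reasoning
  transfer : ∀ y x → 𝟙 (y ≟ τ x) ≡ 𝟙 (x ≟ τ y)
  transfer y x = 𝟙-cong (y ≟ τ x) (x ≟ τ y)
    (λ y≡ → trans (sym (ττ x)) (cong τ (sym y≡))) (λ x≡ → trans (sym (ττ y)) (cong τ (sym x≡)))

enumerates-allFin : ∀ n → Enumerates _≟_ (allFin n)
enumerates-allFin (suc n) zero = cong suc (trans
  (cong (λ xs → ∑ xs (λ x → 𝟙 (x ≟ zero))) (sym (map-tabulate {n = n} id Fin.suc)))
  (trans (∑-map Fin.suc (allFin n) _) (trans (∑-const (allFin n) 0) (*-zeroʳ (length (allFin n))))))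
enumerates-allFin (suc n) (suc a) = trans
  (cong (λ xs → ∑ xs (λ x → 𝟙 (x ≟ suc a))) (sym (map-tabulate {n = n} id Fin.suc)))
  (trans (∑-map Fin.suc (allFin n) _)
    (trans (∑-cong (allFin n) λ x → 𝟙-cong (suc x ≟ suc a) (x ≟ a) suc-injective (cong suc))
      (enumerates-allFin n a)))

vecs : ∀ n s → List (Vec (Fin n) s)
vecs n zero    = [] ∷ []
vecs n (suc s) = cartesianProductWith _∷_ (allFin n) (vecs n s)

_≟ᵛ_ : ∀ {n s} → B.DecidableEquality (Vec (Fin n) s)
_≟ᵛ_ = ≡-dec _≟_

enumerates-vecs : ∀ n s → Enumerates _≟ᵛ_ (vecs n s)
enumerates-vecs n zero    []      = refl
enumerates-vecs n (suc s) (a ∷ u) = begin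
  ∑ (vecs n (suc s)) (λ v → 𝟙 (v ≟ᵛ (a ∷ u)))
    ≡⟨ ∑-product _∷_ (allFin n) (vecs n s) _ ⟩
  ∑ (allFin n) (λ x → ∑ (vecs n s) (λ v → 𝟙 ((x ∷ v) ≟ᵛ (a ∷ u))))
    ≡⟨ ∑-cong (allFin n) (λ x → trans (∑-cong (vecs n s) (λ v → splits x v)) (∑-*ˡ (vecs n s) (𝟙 (x ≟ a)) _)) ⟩
  ∑ (allFin n) (λ x → 𝟙 (x ≟ a) * ∑ (vecs n s) (λ v → 𝟙 (v ≟ᵛ u)))
    ≡⟨ ∑-pick _≟_ (allFin n) (enumerates-allFin n) a _ ⟩
  ∑ (vecs n s) (λ v → 𝟙 (v ≟ᵛ u))
    ≡⟨ enumerates-vecs n s u ⟩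
  1 ∎
  where
  open ≡-Reasoning
  splits : ∀ x v → 𝟙 ((x ∷ v) ≟ᵛ (a ∷ u)) ≡ 𝟙 (x ≟ a) * 𝟙 (v ≟ᵛ u)
  splits x v = trans
    (𝟙-cong ((x ∷ v) ≟ᵛ (a ∷ u)) ((x ≟ a) ×-dec (v ≟ᵛ u)) ∷-injective (λ where (refl , refl) → refl))
    (𝟙-× (x ≟ a) (v ≟ᵛ u))

∑-allFin-1 : ∀ n → ∑ (allFin n) (λ _ → 1) ≡ n
∑-allFin-1 n = trans (∑-const (allFin n) 1) (trans (*-identityʳ _) (length-tabulate {n = n} id))

transpose-fixes : ∀ {n} {i j k : Fin n} → k ≢ i → k ≢ j → transpose i j k ≡ k
transpose-fixes {i = i} {j} {k} k≢i k≢j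
  rewrite dec-false (k ≟ i) k≢i | dec-false (k ≟ j) k≢j = refl

transpose-left : ∀ {n} (i j : Fin n) → transpose i j i ≡ j
transpose-left i j rewrite dec-true (i ≟ i) refl = refl

transpose-right : ∀ {n} (i j : Fin n) → transpose i j j ≡ i
transpose-right i j with j ≟ i
... | yes j≡i = j≡i
... | no _ rewrite dec-true (j ≟ j) refl = refl

transpose-comm : ∀ {n} (i j k : Fin n) → transpose i j k ≡ transpose j i k
transpose-comm i j k with k ≟ i
... | yes refl = sym (transpose-right j i)
... | no k≢i with k ≟ j
...   | yes refl = refl
...   | no _ rewrite dec-false (k ≟ i) k≢i = refl

transpose-involutive : ∀ {n} (i j k : Fin n) → transpose i j (transpose i j k) ≡ k
transpose-involutive i j k = trans (cong (transpose i j) (transpose-comm i j k)) (transpose-inverse i j)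

module RandomInjection (m n : ℕ) where
  Event : Set
  Event = List (Fin m × Fin n)

  _⊨_ : Vec (Fin n) m → Event → Set
  φ ⊨ A = All (λ p → lookup φ (proj₁ p) ≡ proj₂ p) A

  _⊨?_ : B.Decidable _⊨_
  φ ⊨? A = All.all? (λ p → lookup φ (proj₁ p) ≟ proj₂ p) A

  Injective : Vec (Fin n) m → Set
  Injective φ = ∀ i j → lookup φ i ≡ lookup φ j → i ≡ j

  injective? : Decidable Injective
  injective? φ = all? λ i → all? λ j → (lookup φ i ≟ lookup φ j) →-dec (i ≟ j)

  injections : List (Vec (Fin n) m)
  injections = filter injective? (vecs n m)

  open Avoidance injections _⊨?_ public

  Meets : Fin m × Fin n → Fin m × Fin n → Set
  Meets p q = proj₁ p ≡ proj₁ q ⊎ proj₂ p ≡ proj₂ q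

  _~_ : Event → Event → Set
  A ~ B = Any (λ p → Any (Meets p) B) A

  meets? : B.Decidable Meets
  meets? p q = (proj₁ p ≟ proj₁ q) ⊎-dec (proj₂ p ≟ proj₂ q)

  _~?_ : B.Decidable _~_
  A ~? B = Any.any? (λ p → Any.any? (meets? p) B) A

  Hits : Event → List Event → Vec (Fin n) m → Set
  Hits A S φ = Injective φ × (φ ⊨ A × Avoids S φ)

  hits? : ∀ A S → Decidable (Hits A S)
  hits? A S φ = injective? φ ×-dec ((φ ⊨? A) ×-dec avoids? S φ)

  -- Injectivity is moved into the condition so that the sum runs over all vectors, the list on
  -- which `∑-involution` lets a swap act.
  #hits : Event → List Event → ℕ
  #hits A S = ∑ (vecs n m) λ φ → 𝟙 (hits? A S φ)

  #avoidingIn≡#hits : ∀ A S → #avoidingIn A S ≡ #hits A S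
  #avoidingIn≡#hits A S = trans (∑-filter injective? (vecs n m) _)
    (∑-cong (vecs n m) λ φ → sym (𝟙-× (injective? φ) ((φ ⊨? A) ×-dec avoids? S φ)))

  swap : Fin n → Fin n → Vec (Fin n) m → Vec (Fin n) m
  swap y y′ = Vec.map (transpose y y′)

  swap-involutive : ∀ y y′ φ → swap y y′ (swap y y′ φ) ≡ φ
  swap-involutive y y′ φ = trans (sym (map-∘ _ _ φ))
    (trans (map-cong (transpose-involutive y y′) φ) (map-id φ))

  -- Exchanging the values y and y′ turns injections with x ↦ y into injections with x ↦ y′
  -- and keeps S avoided, so no value y′ unused by A is rarer at x than y is.
  swap-hits : ∀ {x y y′ A S φ} → y ∉ map proj₂ A → y′ ∉ map proj₂ A →
              All (λ B → ¬ ((x , y) ∷ []) ~ B) S → Hits ((x , y) ∷ A) S (swap y y′ φ) →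
              lookup φ x ≡ y′ × Hits A S φ
  swap-hits {x} {y} {y′} {A} {S} {φ} y∉ y′∉ apart (inj , x↦y ∷ holds , avoids) =
    φx≡y′ , injφ , All.tabulate holdsφ , All.tabulate avoidsφ
    where
    back : ∀ {i k} → lookup (swap y y′ φ) i ≡ k → lookup φ i ≡ transpose y y′ k
    back {i} eq = trans (sym (transpose-involutive y y′ _))
      (cong (transpose y y′) (trans (sym (lookup-map i (transpose y y′) φ)) eq))
    forth : ∀ {i k} → lookup φ i ≡ k → lookup (swap y y′ φ) i ≡ transpose y y′ k
    forth {i} eq = trans (lookup-map i (transpose y y′) φ) (cong (transpose y y′) eq)
    φx≡y′ : lookup φ x ≡ y′
    φx≡y′ = trans (back x↦y) (transpose-left y y′)
    injφ : Injective φ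
    injφ i j eq = inj i j (trans (forth eq) (sym (forth refl)))
    holdsφ : ∀ {p} → p ∈ A → lookup φ (proj₁ p) ≡ proj₂ p
    holdsφ p∈A = trans (back (All.lookup holds p∈A))
      (transpose-fixes (λ where refl → y∉ (∈-map⁺ proj₂ p∈A)) (λ where refl → y′∉ (∈-map⁺ proj₂ p∈A)))
    -- Suppose φ satisfied `B`. No value of `B` is `y`, since `B` does not conflict with (x , y);
    -- and `y′` is taken by φ only at `x`, where `B` prescribes nothing. So the swap changes no
    -- value prescribed by `B`, and the swapped vector would satisfy `B` too.
    avoidsφ : ∀ {B} → B ∈ S → ¬ φ ⊨ B
    avoidsφ {B} B∈S φ⊨B = All.lookup avoids B∈S (All.tabulate λ {p} p∈B →
      trans (forth (All.lookup φ⊨B p∈B)) (transpose-fixes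
        (λ where refl → All.lookup apart B∈S (here (Any.map (λ where refl → inj₂ refl) p∈B)))
        (λ where refl → All.lookup apart B∈S (here (Any.map
                   (λ where refl → inj₁ (injφ _ _ (trans φx≡y′ (sym (All.lookup φ⊨B p∈B))))) p∈B)))))

  #hits-∷ : ∀ x y A S → y ∉ map proj₂ A → All (λ B → ¬ ((x , y) ∷ []) ~ B) S →
            n * #hits ((x , y) ∷ A) S ≤ suc (length A) * #hits A S
  #hits-∷ x y A S y∉ apart = begin
    n * N                          ≤⟨ *-monoˡ-≤ N n≤ ⟩
    suc (length A) * #free * N     ≡⟨ *-assoc (suc (length A)) #free N ⟩
    suc (length A) * (#free * N)   ≤⟨ *-monoʳ-≤ (suc (length A)) spread ⟩
    suc (length A) * #hits A S     ∎
    where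
    open ≤-Reasoning
    open DecMembership (_≟_ {n}) using (_∈?_)
    N = #hits ((x , y) ∷ A) S
    free? : ∀ z → Dec (z ∉ map proj₂ A)
    free? z = ¬? (z ∈? map proj₂ A)
    #free : ℕ
    #free = ∑ (allFin n) λ z → 𝟙 (free? z)
    1≤#free : 1 ≤ #free
    1≤#free = begin
      1                                            ≡⟨ sym (enumerates-allFin n y) ⟩
      ∑ (allFin n) (λ z → 𝟙 (z ≟ y))
        ≤⟨ ∑-mono (allFin n) (λ z → 𝟙-mono (z ≟ y) (free? z) λ where refl → y∉) ⟩
      #free ∎
    n≤#free+ : n ≤ #free + length A
    n≤#free+ = begin
      n                                                 ≡⟨ sym (∑-allFin-1 n) ⟩
      ∑ (allFin n) (λ _ → 1)                            ≤⟨ ∑-mono (allFin n) cover ⟩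
      ∑ (allFin n) (λ z → 𝟙 (free? z) + ∑ (map proj₂ A) (λ k → 𝟙 (z ≟ k)))
                                                        ≡⟨ ∑-+ (allFin n) _ _ ⟩
      #free + ∑ (allFin n) (λ z → ∑ (map proj₂ A) (λ k → 𝟙 (z ≟ k)))
                                                        ≡⟨ cong (#free +_) (∑-swap (allFin n) (map proj₂ A) _) ⟩
      #free + ∑ (map proj₂ A) (λ k → ∑ (allFin n) (λ z → 𝟙 (z ≟ k)))
                                                        ≡⟨ cong (#free +_) (∑-cong (map proj₂ A) (enumerates-allFin n)) ⟩
      #free + ∑ (map proj₂ A) (λ _ → 1)
        ≡⟨ cong (#free +_) (trans (∑-const (map proj₂ A) 1) (trans (*-identityʳ _) (length-map proj₂ A))) ⟩
      #free + length A ∎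
      where
      cover : ∀ z → 1 ≤ 𝟙 (free? z) + ∑ (map proj₂ A) (λ k → 𝟙 (z ≟ k))
      cover z with z ∈? map proj₂ A
      ... | no _   = s≤s z≤n
      ... | yes z∈ = ≤-trans (≤-reflexive (sym (𝟙-yes (z ≟ z) refl))) (∑-∈ (λ k → 𝟙 (z ≟ k)) z∈)
    n≤ : n ≤ suc (length A) * #free
    n≤ = begin
      n                          ≤⟨ n≤#free+ ⟩
      #free + length A           ≡⟨ cong (#free +_) (sym (*-identityʳ (length A))) ⟩
      #free + length A * 1       ≤⟨ +-monoʳ-≤ #free (*-monoʳ-≤ (length A) 1≤#free) ⟩
      #free + length A * #free   ∎
    pointwise : ∀ z φ → 𝟙 (free? z) * 𝟙 (hits? ((x , y) ∷ A) S (swap y z φ)) ≤ 𝟙 (z ≟ lookup φ x) * 𝟙 (hits? A S φ)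
    pointwise z φ = begin
      𝟙 (free? z) * 𝟙 (hits? ((x , y) ∷ A) S (swap y z φ))
        ≡⟨ sym (𝟙-× (free? z) (hits? ((x , y) ∷ A) S (swap y z φ))) ⟩
      𝟙 (free? z ×-dec hits? ((x , y) ∷ A) S (swap y z φ))
        ≤⟨ 𝟙-mono (free? z ×-dec hits? ((x , y) ∷ A) S (swap y z φ)) ((z ≟ lookup φ x) ×-dec hits? A S φ)
             (λ (z∉ , hits) → case swap-hits {φ = φ} y∉ z∉ apart hits of λ (φx≡z , hits′) → sym φx≡z , hits′) ⟩
      𝟙 ((z ≟ lookup φ x) ×-dec hits? A S φ)
        ≡⟨ 𝟙-× (z ≟ lookup φ x) (hits? A S φ) ⟩
      𝟙 (z ≟ lookup φ x) * 𝟙 (hits? A S φ) ∎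
    spread : #free * N ≤ #hits A S
    spread = begin
      #free * N
        ≡⟨ sym (∑-*ʳ (allFin n) _ N) ⟩
      ∑ (allFin n) (λ z → 𝟙 (free? z) * N)
        ≡⟨ ∑-cong (allFin n) (λ z → cong (𝟙 (free? z) *_)
             (sym (∑-involution _≟ᵛ_ (vecs n m) (enumerates-vecs n m) (swap y z) (swap-involutive y z) _))) ⟩
      ∑ (allFin n) (λ z → 𝟙 (free? z) * ∑ (vecs n m) (λ φ → 𝟙 (hits? ((x , y) ∷ A) S (swap y z φ))))
        ≡⟨ ∑-cong (allFin n) (λ z → sym (∑-*ˡ (vecs n m) (𝟙 (free? z)) _)) ⟩
      ∑ (allFin n) (λ z → ∑ (vecs n m) (λ φ → 𝟙 (free? z) * 𝟙 (hits? ((x , y) ∷ A) S (swap y z φ))))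
        ≤⟨ ∑-mono (allFin n) (λ z → ∑-mono (vecs n m) (pointwise z)) ⟩
      ∑ (allFin n) (λ z → ∑ (vecs n m) (λ φ → 𝟙 (z ≟ lookup φ x) * 𝟙 (hits? A S φ)))
        ≡⟨ ∑-swap (allFin n) (vecs n m) _ ⟩
      ∑ (vecs n m) (λ φ → ∑ (allFin n) (λ z → 𝟙 (z ≟ lookup φ x) * 𝟙 (hits? A S φ)))
        ≡⟨ ∑-cong (vecs n m) (λ φ → ∑-pick _≟_ (allFin n) (enumerates-allFin n) (lookup φ x) (λ _ → 𝟙 (hits? A S φ))) ⟩
      #hits A S ∎

  #hits-bound : ∀ {R} A S → length A ≤ R → Unique (map proj₂ A) → All (λ B → ¬ A ~ B) S →
                n ^ length A * #hits A S ≤ R ^ length A * #hits [] S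
  #hits-bound []            S _     _           _     = ≤-refl
  #hits-bound {R} ((x , y) ∷ A) S |A|<R (y∉ ∷ uniq) apart = begin
    n * n ^ length A * #hits ((x , y) ∷ A) S
      ≡⟨ solve 3 (λ a b c → a :* b :* c := b :* (a :* c)) refl n (n ^ length A) _ ⟩
    n ^ length A * (n * #hits ((x , y) ∷ A) S)
      ≤⟨ *-monoʳ-≤ (n ^ length A) (#hits-∷ x y A S (All¬⇒¬Any y∉)
                                                     (All.map (λ ¬A~B → λ where (here meets) → ¬A~B (here meets)) apart)) ⟩
    n ^ length A * (suc (length A) * #hits A S)
      ≤⟨ *-monoʳ-≤ (n ^ length A) (*-monoˡ-≤ (#hits A S) |A|<R) ⟩
    n ^ length A * (R * #hits A S)
      ≡⟨ solve 3 (λ a b c → b :* (a :* c) := a :* (b :* c)) refl R (n ^ length A) _ ⟩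
    R * (n ^ length A * #hits A S)
      ≤⟨ *-monoʳ-≤ R (#hits-bound A S (<⇒≤ |A|<R) uniq (All.map (_∘ there) apart)) ⟩
    R * (R ^ length A * #hits [] S)             ≡⟨ sym (*-assoc R _ _) ⟩
    R * R ^ length A * #hits [] S               ∎
    where
    open ≤-Reasoning
    open +-*-Solver

  module _ (R : ℕ) .{{_ : NonZero R}} .{{_ : NonZero n}} where

    -- Each pair of A costs a factor at most R / n, and the weights are on the common scale n ^ R.
    weight : Event → ℕ
    weight A = R ^ R * n ^ (R ∸ length A)

    Valid : Event → Set
    Valid A = Unique (map proj₂ A) × length A ≤ R × 0 < length A

    valid⇒~ : ∀ {A} → Valid A → A ~ A
    valid⇒~ {_ ∷ _} _ = here (here (inj₁ refl))

    negDependence : ∀ A S → Valid A → All (λ B → ¬ A ~ B) S → n ^ R * #avoidingIn A S ≤ weight A * #avoiding S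
    negDependence A S (uniq , |A|≤R , _) apart = begin
      n ^ R * #avoidingIn A S                            ≡⟨ cong₂ _*_ n^R (#avoidingIn≡#hits A S) ⟩
      n ^ (R ∸ length A) * n ^ length A * #hits A S      ≡⟨ *-assoc (n ^ (R ∸ length A)) _ _ ⟩
      n ^ (R ∸ length A) * (n ^ length A * #hits A S)
        ≤⟨ *-monoʳ-≤ (n ^ (R ∸ length A)) (#hits-bound A S |A|≤R uniq apart) ⟩
      n ^ (R ∸ length A) * (R ^ length A * #hits [] S)
        ≤⟨ *-monoʳ-≤ (n ^ (R ∸ length A)) (*-monoˡ-≤ _ (^-monoʳ-≤ R |A|≤R)) ⟩
      n ^ (R ∸ length A) * (R ^ R * #hits [] S)
        ≡⟨ solve 3 (λ a b c → a :* (b :* c) := b :* a :* c) refl (n ^ (R ∸ length A)) (R ^ R) _ ⟩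
      weight A * #hits [] S
        ≡⟨ cong (weight A *_) (sym (#avoidingIn≡#hits [] S)) ⟩
      weight A * #avoiding S                             ∎
      where
      open ≤-Reasoning
      open +-*-Solver
      n^R : n ^ R ≡ n ^ (R ∸ length A) * n ^ length A
      n^R = trans (cong (n ^_) (sym (m∸n+n≡m |A|≤R))) (^-distribˡ-+-* n (R ∸ length A) (length A))

    open LocalLemma _~?_ weight (n ^ R) {{m^n≢0 n R}} {Valid} valid⇒~ negDependence public using (Sparse; avoidable)

-- Counting pairs of ordered edges with a common initial segment

_∈?_ : ∀ {n} (x : Fin n) xs → Dec (x ∈ xs)
_∈?_ = DecMembership._∈?_ _≟_

∑-vecs-++ : ∀ {n} p q {t} → p + q ≡ t → (f : List (Fin n) → ℕ) →
            ∑ (vecs n p) (λ a → ∑ (vecs n q) (λ b → f (toList a ++ toList b))) ≡ ∑ (vecs n t) (f ∘ toList)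
∑-vecs-++ {n} zero    q refl f = +-identityʳ _
∑-vecs-++ {n} (suc p) q refl f = trans (∑-product _∷_ (allFin n) (vecs n p) _)
  (trans (∑-cong (allFin n) λ x → ∑-vecs-++ p q refl (f ∘ (x ∷_)))
    (sym (∑-product _∷_ (allFin n) (vecs n (p + q)) _)))

∑-vecs-1 : ∀ n s → ∑ (vecs n s) (λ _ → 1) ≡ n ^ s
∑-vecs-1 n zero    = refl
∑-vecs-1 n (suc s) = trans (∑-product _∷_ (allFin n) (vecs n s) _)
  (trans (∑-cong (allFin n) λ _ → trans (∑-vecs-1 n s) (sym (*-identityˡ (n ^ s))))
    (trans (∑-*ʳ (allFin n) (λ _ → 1) (n ^ s)) (cong (_* n ^ s) (∑-allFin-1 n))))

-- A union bound over the s positions, each of which holds y in one n-th of all vectors. The factor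
-- `n` on the left avoids the exponent s - 1.
∑-vecs-∋ : ∀ n s y → n * ∑ (vecs n s) (λ v → 𝟙 (y ∈? toList v)) ≤ s * n ^ s
∑-vecs-∋ n zero    y = ≤-reflexive (*-zeroʳ n)
∑-vecs-∋ n (suc s) y = begin
  n * ∑ (vecs n (suc s)) (λ v → 𝟙 (y ∈? toList v))
    ≡⟨ cong (n *_) (∑-product _∷_ (allFin n) (vecs n s) _) ⟩
  n * ∑ (allFin n) (λ x → ∑ (vecs n s) (λ v → 𝟙 (y ∈? (x ∷ toList v))))
    ≤⟨ *-monoʳ-≤ n (∑-mono (allFin n) λ x → ∑-mono (vecs n s) λ v →
         𝟙-⊎ (y ∈? (x ∷ toList v)) (x ≟ y) (y ∈? toList v) λ where
           (here refl) → inj₁ refl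
           (there y∈)  → inj₂ y∈) ⟩
  n * ∑ (allFin n) (λ x → ∑ (vecs n s) (λ v → 𝟙 (x ≟ y) + 𝟙 (y ∈? toList v)))
    ≡⟨ cong (n *_) (trans (∑-cong (allFin n) λ x → ∑-+ (vecs n s) _ _) (∑-+ (allFin n) _ _)) ⟩
  n * (∑ (allFin n) (λ x → ∑ (vecs n s) (λ v → 𝟙 (x ≟ y))) + ∑ (allFin n) (λ x → c))
    ≡⟨ cong (n *_) (cong₂ _+_ first second) ⟩
  n * (n ^ s + n * c)
    ≤⟨ *-monoʳ-≤ n (+-monoʳ-≤ (n ^ s) (∑-vecs-∋ n s y)) ⟩
  n * (n ^ s + s * n ^ s)
    ≡⟨ solve 3 (λ a b c → a :* (b :+ c :* b) := (con 1 :+ c) :* (a :* b)) refl n (n ^ s) s ⟩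
  suc s * (n * n ^ s) ∎
  where
  open ≤-Reasoning
  open +-*-Solver
  c = ∑ (vecs n s) (λ v → 𝟙 (y ∈? toList v))
  first : ∑ (allFin n) (λ x → ∑ (vecs n s) (λ v → 𝟙 (x ≟ y))) ≡ n ^ s
  first = trans (∑-swap (allFin n) (vecs n s) _)
    (trans (∑-cong (vecs n s) λ _ → enumerates-allFin n y) (∑-vecs-1 n s))
  second : ∑ (allFin n) (λ x → c) ≡ n * c
  second = trans (∑-const (allFin n) c) (cong (_* c) (length-tabulate {n = n} id))

Triple : ℕ → ℕ → ℕ → Set
Triple n j s = Vec (Fin n) j × Vec (Fin n) s × Vec (Fin n) s

triples : ∀ n j s → List (Triple n j s)
triples n j s = cartesianProduct (vecs n j) (cartesianProduct (vecs n s) (vecs n s))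

module _ {n j s : ℕ} where
  left right flat : Triple n j s → List (Fin n)
  left  (a , b , c) = toList a ++ toList b
  right (a , b , c) = toList a ++ toList c
  flat  (a , b , c) = toList a ++ toList b ++ toList c

  length-flat : ∀ p → length (flat p) ≡ j + (s + s)
  length-flat (a , b , c) = trans (length-++ (toList a)) (cong₂ _+_ (length-toList a)
    (trans (length-++ (toList b)) (cong₂ _+_ (length-toList b) (length-toList c))))

  ∈-flat⁻ : ∀ {x} p → x ∈ flat p → x ∈ left p ⊎ x ∈ right p
  ∈-flat⁻ (a , b , c) x∈ with ∈-++⁻ (toList a) x∈
  ... | inj₁ x∈a = inj₁ (∈-++⁺ˡ x∈a)
  ... | inj₂ x∈bc = Sum.map (∈-++⁺ʳ (toList a)) (∈-++⁺ʳ (toList a)) (∈-++⁻ (toList b) x∈bc)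

  ∑-triples : (f : Triple n j s → ℕ) → ∑ (triples n j s) f ≡
    ∑ (vecs n j) (λ a → ∑ (vecs n s) (λ b → ∑ (vecs n s) (λ c → f (a , b , c))))
  ∑-triples f = trans (∑-product _,_ (vecs n j) _ f)
    (∑-cong (vecs n j) λ a → ∑-product _,_ (vecs n s) (vecs n s) (λ bc → f (a , bc)))

  -- Serves both sides of an event: for pairs of edges of G, `F` tests both edges and `E` the first
  -- one; for pairs of equally coloured targets, `E` is constantly 1. In both cases `k` bounds the
  -- ways to complete the common part to a second edge.
  module _ {r : ℕ} (j+s≡r : j + s ≡ r) (F : List (Fin n) → List (Fin n) → ℕ) (E : List (Fin n) → ℕ) (k : ℕ)
    (extend : ∀ a b → length a ≡ j → length b ≡ s →
              ∑ (vecs n s) (λ c → F (a ++ b) (a ++ toList c)) ≤ E (a ++ b) * k) where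

    ∑-triples-left : (g : List (Fin n) → ℕ) →
      ∑ (triples n j s) (λ p → g (left p) * F (left p) (right p)) ≤ ∑ (vecs n r) (λ v → g (toList v) * E (toList v)) * k
    ∑-triples-left g = begin
      ∑ (triples n j s) (λ p → g (left p) * F (left p) (right p))
        ≡⟨ ∑-triples _ ⟩
      ∑ (vecs n j) (λ a → ∑ (vecs n s) (λ b → ∑ (vecs n s) (λ c →
        g (toList a ++ toList b) * F (toList a ++ toList b) (toList a ++ toList c))))
        ≤⟨ ∑-mono (vecs n j) (λ a → ∑-mono (vecs n s) (λ b → inner a b)) ⟩
      ∑ (vecs n j) (λ a → ∑ (vecs n s) (λ b → g (toList a ++ toList b) * E (toList a ++ toList b) * k))
        ≡⟨ ∑-vecs-++ j s j+s≡r (λ v → g v * E v * k) ⟩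
      ∑ (vecs n r) (λ v → g (toList v) * E (toList v) * k)
        ≡⟨ ∑-*ʳ (vecs n r) _ k ⟩
      ∑ (vecs n r) (λ v → g (toList v) * E (toList v)) * k ∎
      where
      open ≤-Reasoning
      inner : ∀ a b →
        ∑ (vecs n s) (λ c → g (toList a ++ toList b) * F (toList a ++ toList b) (toList a ++ toList c))
        ≤ g (toList a ++ toList b) * E (toList a ++ toList b) * k
      inner a b = begin
        ∑ (vecs n s) (λ c → g ab * F ab (toList a ++ toList c))  ≡⟨ ∑-*ˡ (vecs n s) (g ab) _ ⟩
        g ab * ∑ (vecs n s) (λ c → F ab (toList a ++ toList c))
          ≤⟨ *-monoʳ-≤ (g ab) (extend (toList a) (toList b) (length-toList a) (length-toList b)) ⟩
        g ab * (E ab * k)                                        ≡⟨ sym (*-assoc (g ab) (E ab) k) ⟩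
        g ab * E ab * k                                          ∎
        where ab = toList a ++ toList b

    ∑-triples-total : ∑ (triples n j s) (λ p → F (left p) (right p)) ≤ ∑ (vecs n r) (λ v → E (toList v)) * k
    ∑-triples-total = begin
      ∑ (triples n j s) (λ p → F (left p) (right p))
        ≡⟨ ∑-cong (triples n j s) (λ p → sym (*-identityˡ _)) ⟩
      ∑ (triples n j s) (λ p → 1 * F (left p) (right p))     ≤⟨ ∑-triples-left (λ _ → 1) ⟩
      ∑ (vecs n r) (λ v → 1 * E (toList v)) * k
        ≡⟨ cong (_* k) (∑-cong (vecs n r) λ v → *-identityˡ _) ⟩
      ∑ (vecs n r) (λ v → E (toList v)) * k                  ∎
      where open ≤-Reasoning

    -- A vertex of the union lies in the left or in the right edge. Exchanging the two remainders
    -- maps one case to the other, since `F` is symmetric; hence the factor 2.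
    ∑-triples-∋ : (∀ u v → F u v ≡ F v u) → ∀ x →
      ∑ (triples n j s) (λ p → 𝟙 (x ∈? flat p) * F (left p) (right p)) ≤
      2 * (∑ (vecs n r) (λ v → 𝟙 (x ∈? toList v) * E (toList v)) * k)
    ∑-triples-∋ F-sym x = begin
      ∑ (triples n j s) (λ p → 𝟙 (x ∈? flat p) * F (left p) (right p))
        ≤⟨ ∑-mono (triples n j s) (λ p → ≤-trans
             (*-monoˡ-≤ (F (left p) (right p)) (𝟙-⊎ (x ∈? flat p) (x ∈? left p) (x ∈? right p) (∈-flat⁻ p)))
             (≤-reflexive (*-distribʳ-+ (F (left p) (right p)) (𝟙 (x ∈? left p)) (𝟙 (x ∈? right p))))) ⟩
      ∑ (triples n j s) (λ p → 𝟙 (x ∈? left p) * F (left p) (right p) + 𝟙 (x ∈? right p) * F (left p) (right p))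
        ≡⟨ ∑-+ (triples n j s) _ _ ⟩
      L + ∑ (triples n j s) (λ p → 𝟙 (x ∈? right p) * F (left p) (right p))
        ≡⟨ cong (L +_) mirror ⟩
      L + L
        ≡⟨ cong (L +_) (sym (+-identityʳ L)) ⟩
      2 * L
        ≤⟨ *-monoʳ-≤ 2 (∑-triples-left (λ u → 𝟙 (x ∈? u))) ⟩
      2 * (∑ (vecs n r) (λ v → 𝟙 (x ∈? toList v) * E (toList v)) * k) ∎
      where
      open ≤-Reasoning
      L = ∑ (triples n j s) (λ p → 𝟙 (x ∈? left p) * F (left p) (right p))
      mirror : ∑ (triples n j s) (λ p → 𝟙 (x ∈? right p) * F (left p) (right p)) ≡ L
      mirror = trans (∑-triples _) (trans
        (∑-cong (vecs n j) λ a → trans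
          (∑-swap (vecs n s) (vecs n s) _)
          (∑-cong (vecs n s) λ b → ∑-cong (vecs n s) λ c →
            cong (𝟙 (x ∈? (toList a ++ toList b)) *_) (F-sym _ _)))
        (sym (∑-triples _)))

-- Bad events, their conflicts, and an injection avoiding them

map-proj₂-zip : (xs : List X) (ys : List Y) → length xs ≡ length ys → map proj₂ (zip xs ys) ≡ ys
map-proj₂-zip []       []       _  = refl
map-proj₂-zip (x ∷ xs) (y ∷ ys) eq = cong (y ∷_) (map-proj₂-zip xs ys (cong pred eq))

Any-zip⁻ : {P : X → Set} {Q : Y → Set} (xs : List X) (ys : List Y) →
           Any (λ p → P (proj₁ p) ⊎ Q (proj₂ p)) (zip xs ys) → Any P xs ⊎ Any Q ys
Any-zip⁻ (x ∷ xs) (y ∷ ys) (here pq) = Sum.map here here pq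
Any-zip⁻ (x ∷ xs) (y ∷ ys) (there i) = Sum.map there there (Any-zip⁻ xs ys i)

All-zip-map : (f : X → Y) (xs : List X) → All (λ p → f (proj₁ p) ≡ proj₂ p) (zip xs (map f xs))
All-zip-map f []       = []
All-zip-map f (x ∷ xs) = refl ∷ All-zip-map f xs

asVec : ∀ {k} (xs : List X) → length xs ≡ k → ∃ λ (v : Vec X k) → toList v ≡ xs
asVec xs refl = fromList xs , toList∘fromList xs

enumerates⇒∈ : (_≟_ : B.DecidableEquality X) (xs : List X) → Enumerates _≟_ xs → ∀ a → a ∈ xs
enumerates⇒∈ _≟_ xs enum a with ∑>0⇒∃ xs (_≟ a) (≤-reflexive (sym (enum a)))
... | _ , a∈ , refl = a∈

∑-split : (xs : List X) (ys : List Y) (f : X → ℕ) (g : Y → ℕ) →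
          ∑ xs (λ x → ∑ ys (λ y → f x + g y)) ≡ ∑ xs f * ∑ ys (λ _ → 1) + ∑ xs (λ _ → 1) * ∑ ys g
∑-split xs ys f g = begin
  ∑ xs (λ x → ∑ ys (λ y → f x + g y))
    ≡⟨ ∑-cong xs (λ x → ∑-+ ys _ g) ⟩
  ∑ xs (λ x → ∑ ys (λ y → f x) + ∑ ys g)
    ≡⟨ ∑-+ xs _ _ ⟩
  ∑ xs (λ x → ∑ ys (λ y → f x)) + ∑ xs (λ x → ∑ ys g)
    ≡⟨ cong₂ _+_ (∑-cong xs λ x → trans (∑-cong ys λ _ → sym (*-identityʳ (f x))) (∑-*ˡ ys (f x) _))
                 (∑-cong xs λ x → sym (*-identityˡ _)) ⟩
  ∑ xs (λ x → f x * ∑ ys (λ _ → 1)) + ∑ xs (λ x → 1 * ∑ ys g)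
    ≡⟨ cong₂ _+_ (∑-*ʳ xs f _) (∑-*ʳ xs _ _) ⟩
  ∑ xs f * ∑ ys (λ _ → 1) + ∑ xs (λ _ → 1) * ∑ ys g ∎
  where open ≡-Reasoning

-- 4 from the local lemma, r for the choice of j, r + r vertices of an event, 2 * suc r for the
-- conflicts at one vertex, and (r + r) ^ (r + r) from the weights.
sizeConstant : ℕ → ℕ
sizeConstant r = 8 * r * suc r * ((r + r) * (r + r) ^ (r + r))

-- G is the set of ordered edges of the hypergraph to be embedded, and Same relates ordered edges of
-- the host of equal colour. A pair of edges meeting in j vertices is listed as a ++ b and a ++ c,
-- where a lists the common vertices.
module Embedding
  (m n r ℓ : ℕ) .{{_ : NonZero n}} .{{_ : NonZero r}} (m≤n : m ≤ n) (ℓ≤r : ℓ ≤ r)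
  {G : List (Fin m) → Set} (G? : Decidable G)
  {Same : List (Fin n) → List (Fin n) → Set} (same? : B.Decidable Same)
  (same-sym : ∀ {u v} → Same u v → Same v u)
  (js : List ℕ) (js≤ℓ : ∀ {j} → j ∈ js → j ≤ ℓ) (|js|≤r : length js ≤ r)
  (V D K : ℕ)
  (edges∋ : ∀ x → ∑ (vecs m r) (λ v → 𝟙 (x ∈? toList v) * 𝟙 (G? (toList v))) ≤ V)
  (edges⊇ : ∀ a → length a ≡ ℓ → ∑ (vecs m (r ∸ ℓ)) (λ c → 𝟙 (G? (a ++ toList c))) ≤ D)
  (mates : ∀ {j} → j ∈ js → ∀ a b → length a ≡ j → length b ≡ r ∸ j →
           ∑ (vecs n (r ∸ j)) (λ c → 𝟙 (same? (a ++ b) (a ++ toList c))) ≤ K)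
  (small : sizeConstant r * (V * D * K) ≤ n ^ (r ∸ ℓ))
  where

  open RandomInjection m n

  R : ℕ
  R = r + r

  instance
    R≢0 : NonZero R
    R≢0 = >-nonZero (≤-trans (>-nonZero⁻¹ r) (m≤m+n r r))

  goodDom? : ∀ {j s} (p : Triple m j s) → Dec (G (left p) × G (right p))
  goodDom? p = G? (left p) ×-dec G? (right p)

  -- Distinct target vertices make the events valid, and no relevant event is lost, as φ is
  -- injective. The domain side may keep pairs whose remainders overlap: combined with distinct
  -- targets they prescribe two values for one vertex, so no φ satisfies them, and only upper bounds
  -- on their number are used.
  goodCod? : ∀ {j s} (q : Triple n j s) → Dec (Same (left q) (right q) × Unique (flat q))
  goodCod? q = same? (left q) (right q) ×-dec unique? _≟_ (flat q)

  doms : ∀ j → List (Triple m j (r ∸ j))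
  doms j = filter goodDom? (triples m j (r ∸ j))

  cods : ∀ j → List (Triple n j (r ∸ j))
  cods j = filter goodCod? (triples n j (r ∸ j))

  event : ∀ {j s} → Triple m j s → Triple n j s → Event
  event p q = zip (flat p) (flat q)

  events : ℕ → List Event
  events j = cartesianProductWith event (doms j) (cods j)

  allEvents : List Event
  allEvents = concatMap events js

  module Count {j} (j∈js : j ∈ js) where
    s : ℕ
    s = r ∸ j
    j≤ℓ : j ≤ ℓ
    j≤ℓ = js≤ℓ j∈js
    j+s≡r : j + s ≡ r
    j+s≡r = m+[n∸m]≡n (≤-trans j≤ℓ ℓ≤r)

    Dʲ : ℕ
    Dʲ = n ^ (ℓ ∸ j) * D

    -- Guess the next ℓ - j vertices in one of m^(ℓ-j) ≤ n^(ℓ-j) ways, then apply the bound for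
    -- ℓ-tuples. This is how all smaller degrees are controlled by `D` alone.
    edges⊇ʲ : ∀ a → length a ≡ j → ∑ (vecs m s) (λ c → 𝟙 (G? (a ++ toList c))) ≤ Dʲ
    edges⊇ʲ a |a|≡j = begin
      ∑ (vecs m s) (λ c → 𝟙 (G? (a ++ toList c)))
        ≡⟨ sym (∑-vecs-++ (ℓ ∸ j) (r ∸ ℓ) lengths (λ c → 𝟙 (G? (a ++ c)))) ⟩
      ∑ (vecs m (ℓ ∸ j)) (λ b → ∑ (vecs m (r ∸ ℓ)) (λ c → 𝟙 (G? (a ++ toList b ++ toList c))))
        ≡⟨ ∑-cong (vecs m (ℓ ∸ j)) (λ b → ∑-cong (vecs m (r ∸ ℓ)) λ c →
             cong (λ v → 𝟙 (G? v)) (sym (++-assoc a (toList b) (toList c)))) ⟩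
      ∑ (vecs m (ℓ ∸ j)) (λ b → ∑ (vecs m (r ∸ ℓ)) (λ c → 𝟙 (G? ((a ++ toList b) ++ toList c))))
        ≤⟨ ∑-mono (vecs m (ℓ ∸ j)) (λ b → ≤-trans (edges⊇ (a ++ toList b) (|ab| b)) (≤-reflexive (sym (*-identityˡ D)))) ⟩
      ∑ (vecs m (ℓ ∸ j)) (λ b → 1 * D)
        ≡⟨ trans (∑-*ʳ (vecs m (ℓ ∸ j)) _ D) (cong (_* D) (∑-vecs-1 m (ℓ ∸ j))) ⟩
      m ^ (ℓ ∸ j) * D
        ≤⟨ *-monoˡ-≤ D (^-monoˡ-≤ (ℓ ∸ j) m≤n) ⟩
      Dʲ ∎
      where
      open ≤-Reasoning
      lengths : (ℓ ∸ j) + (r ∸ ℓ) ≡ s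
      lengths = trans (+-comm (ℓ ∸ j) (r ∸ ℓ)) (trans (sym (+-∸-assoc (r ∸ ℓ) j≤ℓ)) (cong (_∸ j) (m∸n+n≡m ℓ≤r)))
      |ab| : (b : Vec (Fin m) (ℓ ∸ j)) → length (a ++ toList b) ≡ ℓ
      |ab| b = trans (length-++ a) (trans (cong₂ _+_ |a|≡j (length-toList b)) (m+[n∸m]≡n j≤ℓ))

    extendDom : ∀ a b → length a ≡ j → length b ≡ s →
                ∑ (vecs m s) (λ c → 𝟙 (G? (a ++ b) ×-dec G? (a ++ toList c))) ≤ 𝟙 (G? (a ++ b)) * Dʲ
    extendDom a b |a| |b| = begin
      ∑ (vecs m s) (λ c → 𝟙 (G? (a ++ b) ×-dec G? (a ++ toList c)))
        ≡⟨ ∑-cong (vecs m s) (λ c → 𝟙-× (G? (a ++ b)) (G? (a ++ toList c))) ⟩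
      ∑ (vecs m s) (λ c → 𝟙 (G? (a ++ b)) * 𝟙 (G? (a ++ toList c)))
        ≡⟨ ∑-*ˡ (vecs m s) (𝟙 (G? (a ++ b))) _ ⟩
      𝟙 (G? (a ++ b)) * ∑ (vecs m s) (λ c → 𝟙 (G? (a ++ toList c)))
        ≤⟨ *-monoʳ-≤ (𝟙 (G? (a ++ b))) (edges⊇ʲ a |a|) ⟩
      𝟙 (G? (a ++ b)) * Dʲ ∎
      where open ≤-Reasoning

    extendCod : ∀ a b → length a ≡ j → length b ≡ s →
                ∑ (vecs n s) (λ c → 𝟙 (same? (a ++ b) (a ++ toList c))) ≤ 1 * K
    extendCod a b |a| |b| = ≤-trans (mates j∈js a b |a| |b|) (≤-reflexive (sym (*-identityˡ K)))

    open ≤-Reasoning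

    -- Edges are nonempty because r is positive, so summing `edges∋` over the at most n vertices
    -- counts every ordered edge at least once.
    #doms : ∑ (doms j) (λ _ → 1) ≤ n * (V * Dʲ)
    #doms = begin
      ∑ (doms j) (λ _ → 1)
        ≡⟨ ∑-filter goodDom? (triples m j s) _ ⟩
      ∑ (triples m j s) (λ p → 𝟙 (goodDom? p) * 1)
        ≡⟨ ∑-cong (triples m j s) (λ p → *-identityʳ _) ⟩
      ∑ (triples m j s) (λ p → 𝟙 (goodDom? p))
        ≤⟨ ∑-triples-total j+s≡r (λ u v → 𝟙 (G? u ×-dec G? v)) (λ u → 𝟙 (G? u)) Dʲ extendDom ⟩
      ∑ (vecs m r) (λ v → 𝟙 (G? (toList v))) * Dʲ
        ≤⟨ *-monoˡ-≤ Dʲ (∑-mono (vecs m r) everyEdge) ⟩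
      ∑ (vecs m r) (λ v → ∑ (allFin m) (λ x → 𝟙 (x ∈? toList v) * 𝟙 (G? (toList v)))) * Dʲ
        ≡⟨ cong (_* Dʲ) (∑-swap (vecs m r) (allFin m) _) ⟩
      ∑ (allFin m) (λ x → ∑ (vecs m r) (λ v → 𝟙 (x ∈? toList v) * 𝟙 (G? (toList v)))) * Dʲ
        ≤⟨ *-monoˡ-≤ Dʲ (∑-bound (allFin m) (λ {x} _ → edges∋ x)) ⟩
      length (allFin m) * V * Dʲ
        ≡⟨ cong (λ k → k * V * Dʲ) (length-tabulate {n = m} id) ⟩
      m * V * Dʲ
        ≤⟨ *-monoˡ-≤ Dʲ (*-monoˡ-≤ V m≤n) ⟩
      n * V * Dʲ
        ≡⟨ *-assoc n V Dʲ ⟩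
      n * (V * Dʲ) ∎
      where
      everyEdge : ∀ v → 𝟙 (G? (toList v)) ≤ ∑ (allFin m) (λ x → 𝟙 (x ∈? toList v) * 𝟙 (G? (toList v)))
      everyEdge v with toList v in eq
      ... | [] = contradiction (trans (sym (length-toList v)) (cong length eq)) (≢-nonZero⁻¹ r)
      ... | x ∷ xs = begin
        𝟙 (G? (x ∷ xs))                            ≡⟨ sym (*-identityˡ _) ⟩
        1 * 𝟙 (G? (x ∷ xs))
          ≡⟨ cong (_* 𝟙 (G? (x ∷ xs))) (sym (𝟙-yes (x ∈? (x ∷ xs)) (here refl))) ⟩
        𝟙 (x ∈? (x ∷ xs)) * 𝟙 (G? (x ∷ xs))
          ≤⟨ ∑-∈ (λ y → 𝟙 (y ∈? (x ∷ xs)) * 𝟙 (G? (x ∷ xs))) (enumerates⇒∈ _≟_ (allFin m) (enumerates-allFin m) x) ⟩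
        ∑ (allFin m) (λ y → 𝟙 (y ∈? (x ∷ xs)) * 𝟙 (G? (x ∷ xs))) ∎

    #doms∋ : ∀ x → ∑ (doms j) (λ p → 𝟙 (x ∈? flat p)) ≤ 2 * (V * Dʲ)
    #doms∋ x = begin
      ∑ (doms j) (λ p → 𝟙 (x ∈? flat p))
        ≡⟨ ∑-filter goodDom? (triples m j s) _ ⟩
      ∑ (triples m j s) (λ p → 𝟙 (goodDom? p) * 𝟙 (x ∈? flat p))
        ≡⟨ ∑-cong (triples m j s) (λ p → *-comm (𝟙 (goodDom? p)) _) ⟩
      ∑ (triples m j s) (λ p → 𝟙 (x ∈? flat p) * 𝟙 (goodDom? p))
        ≤⟨ ∑-triples-∋ j+s≡r (λ u v → 𝟙 (G? u ×-dec G? v)) (λ u → 𝟙 (G? u)) Dʲ extendDom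
             (λ u v → 𝟙-cong (G? u ×-dec G? v) (G? v ×-dec G? u) ×-swap ×-swap) x ⟩
      2 * (∑ (vecs m r) (λ v → 𝟙 (x ∈? toList v) * 𝟙 (G? (toList v))) * Dʲ)
        ≤⟨ *-monoʳ-≤ 2 (*-monoˡ-≤ Dʲ (edges∋ x)) ⟩
      2 * (V * Dʲ) ∎

    drop-unique : ∀ {j s} (q : Triple n j s) → 𝟙 (goodCod? q) ≤ 𝟙 (same? (left q) (right q))
    drop-unique q = 𝟙-mono (goodCod? q) (same? (left q) (right q)) proj₁

    #cods : ∑ (cods j) (λ _ → 1) ≤ n ^ r * K
    #cods = begin
      ∑ (cods j) (λ _ → 1)
        ≡⟨ ∑-filter goodCod? (triples n j s) _ ⟩
      ∑ (triples n j s) (λ q → 𝟙 (goodCod? q) * 1)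
        ≤⟨ ∑-mono (triples n j s) (λ q → ≤-trans (≤-reflexive (*-identityʳ _)) (drop-unique q)) ⟩
      ∑ (triples n j s) (λ q → 𝟙 (same? (left q) (right q)))
        ≤⟨ ∑-triples-total j+s≡r (λ u v → 𝟙 (same? u v)) (λ _ → 1) K extendCod ⟩
      ∑ (vecs n r) (λ _ → 1) * K
        ≡⟨ cong (_* K) (∑-vecs-1 n r) ⟩
      n ^ r * K ∎

    #cods∋ : ∀ y → n * ∑ (cods j) (λ q → 𝟙 (y ∈? flat q)) ≤ 2 * (r * n ^ r * K)
    #cods∋ y = begin
      n * ∑ (cods j) (λ q → 𝟙 (y ∈? flat q))
        ≡⟨ cong (n *_) (∑-filter goodCod? (triples n j s) _) ⟩
      n * ∑ (triples n j s) (λ q → 𝟙 (goodCod? q) * 𝟙 (y ∈? flat q))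
        ≤⟨ *-monoʳ-≤ n (∑-mono (triples n j s) λ q → ≤-trans
             (*-monoˡ-≤ (𝟙 (y ∈? flat q)) (drop-unique q)) (≤-reflexive (*-comm (𝟙 (same? (left q) (right q))) _))) ⟩
      n * ∑ (triples n j s) (λ q → 𝟙 (y ∈? flat q) * 𝟙 (same? (left q) (right q)))
        ≤⟨ *-monoʳ-≤ n (∑-triples-∋ j+s≡r (λ u v → 𝟙 (same? u v)) (λ _ → 1) K extendCod
             (λ u v → 𝟙-cong (same? u v) (same? v u) same-sym same-sym) y) ⟩
      n * (2 * (∑ (vecs n r) (λ v → 𝟙 (y ∈? toList v) * 1) * K))
        ≡⟨ cong (λ k → n * (2 * (k * K))) (∑-cong (vecs n r) λ v → *-identityʳ _) ⟩
      n * (2 * (c * K))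
        ≡⟨ solve 3 (λ a b d → a :* (con 2 :* (b :* d)) := con 2 :* (a :* b :* d)) refl n c K ⟩
      2 * (n * c * K)
        ≤⟨ *-monoʳ-≤ 2 (*-monoˡ-≤ K (∑-vecs-∋ n r y)) ⟩
      2 * (r * n ^ r * K) ∎
      where
      open +-*-Solver
      c = ∑ (vecs n r) (λ v → 𝟙 (y ∈? toList v))

    length-event : (p : Triple m j s) (q : Triple n j s) → length (event p q) ≡ j + (s + s)
    length-event p q = trans (length-zipWith _,_ (flat p) (flat q))
      (trans (cong₂ _⊓_ (length-flat p) (length-flat q)) (⊓-idem (j + (s + s))))

    R≡j+ : R ≡ j + (j + (s + s))
    R≡j+ = trans (cong₂ _+_ (sym j+s≡r) (sym j+s≡r))
      (solve 2 (λ a b → (a :+ b) :+ (a :+ b) := a :+ (a :+ (b :+ b))) refl j s)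
      where open +-*-Solver

    -- The two edges span 2r - j vertices, so of the scale `n ^ R`, with R = 2r, a factor `n ^ j` is
    -- left over.
    weight-event : (p : Triple m j s) (q : Triple n j s) → weight R (event p q) ≡ R ^ R * n ^ j
    weight-event p q = cong (λ k → R ^ R * n ^ k) (trans (cong (R ∸_) (length-event p q))
      (trans (cong (_∸ (j + (s + s))) R≡j+) (m+n∸n≡m j (j + (s + s)))))

    valid-event : (p : Triple m j s) (q : Triple n j s) → Unique (flat q) → Valid R (event p q)
    valid-event p q uniq =
      subst Unique (sym (map-proj₂-zip (flat p) (flat q) (trans (length-flat p) (sym (length-flat q))))) uniq ,
      ≤-trans (≤-reflexive (length-event p q)) (≤-trans (m≤n+m _ j) (≤-reflexive (sym R≡j+))) ,
      ≤-trans (≤-trans (>-nonZero⁻¹ r) (≤-trans (≤-reflexive (sym j+s≡r)) (+-monoʳ-≤ j (m≤m+n s s))))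
        (≤-reflexive (sym (length-event p q)))

    conflict-event : ∀ A (p : Triple m j s) (q : Triple n j s) → 𝟙 (A ~? event p q) ≤
                     ∑ A (λ z → 𝟙 (proj₁ z ∈? flat p) + 𝟙 (proj₂ z ∈? flat q))
    conflict-event A p q = ≤-trans (𝟙-any (λ z → Any.any? (meets? z) (event p q)) A)
      (∑-mono A λ z → 𝟙-⊎ (Any.any? (meets? z) (event p q)) (proj₁ z ∈? flat p) (proj₂ z ∈? flat q)
        (Any-zip⁻ (flat p) (flat q)))

    cost : ℕ
    cost = 2 * suc r * (n ^ ℓ * n ^ r * (V * D * K))

    -- The first summand counts events through the vertex x of G, the second those through the host
    -- vertex y. Dropping x from the domain count costs a factor n, and forcing y into the targets
    -- gains it back. The contributions 2 and 2r give `2 * suc r`, and the `n ^ j` of the weight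
    -- merges with the `n ^ (ℓ ∸ j)` of `Dʲ` into `n ^ ℓ`, so that `cost` does not depend on j.
    perVertex : ∀ x y → n ^ j * (∑ (doms j) (λ p → 𝟙 (x ∈? flat p)) * ∑ (cods j) (λ _ → 1) +
                ∑ (doms j) (λ _ → 1) * ∑ (cods j) (λ q → 𝟙 (y ∈? flat q))) ≤ cost
    perVertex x y = begin
      n ^ j * (∑ (doms j) (λ p → 𝟙 (x ∈? flat p)) * ∑ (cods j) (λ _ → 1) + ∑ (doms j) (λ _ → 1) * c)
        ≤⟨ *-monoʳ-≤ (n ^ j) (+-mono-≤ (*-mono-≤ (#doms∋ x) #cods) (*-monoˡ-≤ c #doms)) ⟩
      n ^ j * (2 * (V * Dʲ) * (n ^ r * K) + n * (V * Dʲ) * c)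
        ≡⟨ cong (λ k → n ^ j * (2 * (V * Dʲ) * (n ^ r * K) + k))
             (solve 3 (λ a b d → a :* b :* d := b :* (a :* d)) refl n (V * Dʲ) c) ⟩
      n ^ j * (2 * (V * Dʲ) * (n ^ r * K) + V * Dʲ * (n * c))
        ≤⟨ *-monoʳ-≤ (n ^ j) (+-monoʳ-≤ (2 * (V * Dʲ) * (n ^ r * K)) (*-monoʳ-≤ (V * Dʲ) (#cods∋ y))) ⟩
      n ^ j * (2 * (V * Dʲ) * (n ^ r * K) + V * Dʲ * (2 * (r * n ^ r * K)))
        ≡⟨ solve 7 (λ nj v nlj d nr k r′ →
             nj :* (con 2 :* (v :* (nlj :* d)) :* (nr :* k) :+ v :* (nlj :* d) :* (con 2 :* (r′ :* nr :* k)))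
             := con 2 :* (con 1 :+ r′) :* (nj :* nlj :* nr :* (v :* d :* k))) refl (n ^ j) V (n ^ (ℓ ∸ j)) D (n ^ r) K r ⟩
      2 * suc r * (n ^ j * n ^ (ℓ ∸ j) * n ^ r * (V * D * K))
        ≡⟨ cong (λ k → 2 * suc r * (k * n ^ r * (V * D * K)))
             (trans (sym (^-distribˡ-+-* n j (ℓ ∸ j))) (cong (n ^_) (m+[n∸m]≡n j≤ℓ))) ⟩
      cost ∎
      where
      open +-*-Solver
      c = ∑ (cods j) (λ q → 𝟙 (y ∈? flat q))

    -- Every conflict happens at one of the at most `R` pairs of `A`. At a fixed pair the condition
    -- concerns either the domain triple or the target triple alone, so the double sum splits into
    -- products of counts.
    conflicts : ∀ A → length A ≤ R → ∑ (events j) (λ B → 𝟙 (A ~? B) * weight R B) ≤ R ^ R * (R * cost)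
    conflicts A |A|≤R = begin
      ∑ (events j) (λ B → 𝟙 (A ~? B) * weight R B)
        ≡⟨ ∑-product event (doms j) (cods j) _ ⟩
      ∑ (doms j) (λ p → ∑ (cods j) (λ q → 𝟙 (A ~? event p q) * weight R (event p q)))
        ≤⟨ ∑-mono (doms j) (λ p → ∑-mono (cods j) λ q → *-mono-≤ (conflict-event A p q) (≤-reflexive (weight-event p q))) ⟩
      ∑ (doms j) (λ p → ∑ (cods j) (λ q → ∑ A (λ z → h z p q) * (R ^ R * n ^ j)))
        ≡⟨ trans (∑-cong (doms j) (λ p → ∑-*ʳ (cods j) _ _)) (∑-*ʳ (doms j) _ _) ⟩
      ∑ (doms j) (λ p → ∑ (cods j) (λ q → ∑ A (λ z → h z p q))) * (R ^ R * n ^ j)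
        ≡⟨ cong (_* (R ^ R * n ^ j)) (trans (∑-cong (doms j) (λ p → ∑-swap (cods j) A _)) (∑-swap (doms j) A _)) ⟩
      ∑ A (λ z → ∑ (doms j) (λ p → ∑ (cods j) (λ q → h z p q))) * (R ^ R * n ^ j)
        ≡⟨ cong (_* (R ^ R * n ^ j)) (∑-cong A λ z →
             ∑-split (doms j) (cods j) (λ p → 𝟙 (proj₁ z ∈? flat p)) (λ q → 𝟙 (proj₂ z ∈? flat q))) ⟩
      ∑ A g * (R ^ R * n ^ j)
        ≡⟨ solve 3 (λ a b c → a :* (b :* c) := b :* (c :* a)) refl (∑ A g) (R ^ R) (n ^ j) ⟩
      R ^ R * (n ^ j * ∑ A g)
        ≡⟨ cong (R ^ R *_) (sym (∑-*ˡ A (n ^ j) g)) ⟩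
      R ^ R * ∑ A (λ z → n ^ j * g z)
        ≤⟨ *-monoʳ-≤ (R ^ R) (∑-bound A λ {z} _ → perVertex (proj₁ z) (proj₂ z)) ⟩
      R ^ R * (length A * cost)
        ≤⟨ *-monoʳ-≤ (R ^ R) (*-monoˡ-≤ cost |A|≤R) ⟩
      R ^ R * (R * cost) ∎
      where
      open +-*-Solver
      h : Fin m × Fin n → Triple m j s → Triple n j s → ℕ
      h z p q = 𝟙 (proj₁ z ∈? flat p) + 𝟙 (proj₂ z ∈? flat q)
      g : Fin m × Fin n → ℕ
      g z = ∑ (doms j) (λ p → 𝟙 (proj₁ z ∈? flat p)) * ∑ (cods j) (λ _ → 1) +
            ∑ (doms j) (λ _ → 1) * ∑ (cods j) (λ q → 𝟙 (proj₂ z ∈? flat q))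

  sparse : Sparse R allEvents
  sparse A (_ , |A|≤R , _) = begin
    4 * ∑ allEvents (λ B → 𝟙 (A ~? B) * weight R B)
      ≡⟨ cong (4 *_) (∑-concatMap events js _) ⟩
    4 * ∑ js (λ j → ∑ (events j) (λ B → 𝟙 (A ~? B) * weight R B))
      ≤⟨ *-monoʳ-≤ 4 (∑-bound js λ j∈js → Count.conflicts j∈js A |A|≤R) ⟩
    4 * (length js * (R ^ R * (R * (2 * suc r * (n ^ ℓ * n ^ r * (V * D * K))))))
      ≤⟨ *-monoʳ-≤ 4 (*-monoˡ-≤ _ |js|≤r) ⟩
    4 * (r * (R ^ R * (R * (2 * suc r * (n ^ ℓ * n ^ r * (V * D * K))))))
      ≡⟨ solve 6 (λ r′ rr q nl nr x → con 4 :* (r′ :* (rr :* (q :* (con 2 :* (con 1 :+ r′) :* (nl :* nr :* x)))))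
           := con 8 :* r′ :* (con 1 :+ r′) :* (q :* rr) :* x :* (nl :* nr)) refl r (R ^ R) R (n ^ ℓ) (n ^ r) (V * D * K) ⟩
    sizeConstant r * (V * D * K) * (n ^ ℓ * n ^ r)
      ≤⟨ *-monoˡ-≤ (n ^ ℓ * n ^ r) small ⟩
    n ^ (r ∸ ℓ) * (n ^ ℓ * n ^ r)
      ≡⟨ sym (*-assoc (n ^ (r ∸ ℓ)) (n ^ ℓ) (n ^ r)) ⟩
    n ^ (r ∸ ℓ) * n ^ ℓ * n ^ r
      ≡⟨ cong (_* n ^ r) (trans (sym (^-distribˡ-+-* n (r ∸ ℓ) ℓ)) (cong (n ^_) (m∸n+n≡m ℓ≤r))) ⟩
    n ^ r * n ^ r
      ≡⟨ sym (^-distribˡ-+-* n r r) ⟩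
    n ^ R ∎
    where
    open ≤-Reasoning
    open +-*-Solver

  valid : All (Valid R) allEvents
  valid = All.tabulate λ B∈ → go (find (∈-concatMap⁻ events {xs = js} B∈))
    where
    go : ∀ {B} → (∃ λ j → j ∈ js × B ∈ events j) → Valid R B
    go (j , j∈js , B∈) with ∈-cartesianProductWith⁻ event (doms j) (cods j) B∈
    ... | p , q , _ , q∈ , refl = Count.valid-event j∈js p q
      (proj₂ (proj₂ (∈-filter⁻ goodCod? {xs = triples n j (r ∸ j)} q∈)))

  someInjection : 0 < #avoiding []
  someInjection = ∑-∈ (λ φ → 𝟙 (avoids? [] φ)) (∈-filter⁺ injective?
    (enumerates⇒∈ _≟ᵛ_ (vecs n m) (enumerates-vecs n m) (Vec.tabulate λ x → inject≤ x m≤n))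
    λ i j eq → inject≤-injective m≤n m≤n i j (trans (sym (lookup∘tabulate _ i)) (trans eq (lookup∘tabulate _ j))))

  ∈-triples : ∀ {N j s} (p : Triple N j s) → p ∈ triples N j s
  ∈-triples (a , b , c) = ∈-cartesianProduct⁺ (∈-vecs a) (∈-cartesianProduct⁺ (∈-vecs b) (∈-vecs c))
    where
    ∈-vecs : ∀ {N s} (v : Vec (Fin N) s) → v ∈ vecs N s
    ∈-vecs = enumerates⇒∈ _≟ᵛ_ (vecs _ _) (enumerates-vecs _ _)

  flat-map : ∀ {j s} (f : Fin m → Fin n) (p : Triple m j s) →
             flat (Vec.map f (proj₁ p) , Vec.map f (proj₁ (proj₂ p)) , Vec.map f (proj₂ (proj₂ p))) ≡ map f (flat p)
  flat-map f (a , b , c) = sym (trans (map-++ f (toList a) _) (cong₂ _++_ (sym (toList-map f a))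
    (trans (map-++ f (toList b) _) (cong₂ _++_ (sym (toList-map f b)) (sym (toList-map f c))))))

  map-++-toList : ∀ {j s} (f : Fin m → Fin n) (a : Vec (Fin m) j) (b : Vec (Fin m) s) →
                  map f (toList a ++ toList b) ≡ toList (Vec.map f a) ++ toList (Vec.map f b)
  map-++-toList f a b = trans (map-++ f (toList a) (toList b)) (sym (cong₂ _++_ (toList-map f a) (toList-map f b)))

  -- If φ gave two such edges images of the same colour, the images under φ would form a triple in
  -- `cods`, and the event pairing the vertices with these images would be a listed event that φ
  -- satisfies by construction.
  embedding : ∃ λ (φ : Fin m → Fin n) → (∀ {i j} → φ i ≡ φ j → i ≡ j) ×
    (∀ {j} → j ∈ js → ∀ a b c → length a ≡ j → length b ≡ r ∸ j → length c ≡ r ∸ j →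
     G (a ++ b) → G (a ++ c) → Unique (map φ (a ++ b ++ c)) → ¬ Same (map φ (a ++ b)) (map φ (a ++ c)))
  embedding with ∑>0⇒∃ injections (avoids? allEvents) (avoidable R allEvents valid sparse someInjection)
  ... | φ , φ∈ , avoids = lookup φ , (λ {i} {j} → proj₂ (∈-filter⁻ injective? {xs = vecs n m} φ∈) i j) , proper
    where
    proper : ∀ {j} → j ∈ js → ∀ a b c → length a ≡ j → length b ≡ r ∸ j → length c ≡ r ∸ j →
             G (a ++ b) → G (a ++ c) → Unique (map (lookup φ) (a ++ b ++ c)) →
             ¬ Same (map (lookup φ) (a ++ b)) (map (lookup φ) (a ++ c))
    proper {j} j∈js a b c |a| |b| |c| Gab Gac uniq same
      with asVec a |a| | asVec b |b| | asVec c |c|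
    ... | a′ , refl | b′ , refl | c′ , refl = All.lookup avoids
      (∈-concatMap⁺ events (lose j∈js (∈-cartesianProductWith⁺ event
        (∈-filter⁺ goodDom? (∈-triples p) (Gab , Gac))
        (∈-filter⁺ goodCod? (∈-triples q)
          (subst₂ Same (map-++-toList f a′ b′) (map-++-toList f a′ c′) same ,
           subst Unique (sym (flat-map f p)) uniq)))))
      (subst (λ ys → φ ⊨ zip (flat p) ys) (sym (flat-map f p)) (All-zip-map f (flat p)))
      where
      f = lookup φ
      p : Triple m j (r ∸ j)
      p = a′ , b′ , c′
      q : Triple n j (r ∸ j)
      q = Vec.map f a′ , Vec.map f b′ , Vec.map f c′

-- Sets and their orderings

toSet : ∀ {n} → List (Fin n) → Subset n
toSet []       = ⊥
toSet (x ∷ xs) = ⁅ x ⁆ ∪ toSet xs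

∈-toSet⁺ : ∀ {n} {x : Fin n} {xs} → x ∈ xs → x ∈ˢ toSet xs
∈-toSet⁺ {x = x} (here refl) = x∈p∪q⁺ (inj₁ (x∈⁅x⁆ x))
∈-toSet⁺ (there x∈)          = x∈p∪q⁺ (inj₂ (∈-toSet⁺ x∈))

∈-toSet⁻ : ∀ {n} {x : Fin n} xs → x ∈ˢ toSet xs → x ∈ xs
∈-toSet⁻ []       x∈ = contradiction x∈ ∉⊥
∈-toSet⁻ (y ∷ xs) x∈ with x∈p∪q⁻ ⁅ y ⁆ (toSet xs) x∈
... | inj₁ x∈y  = here (x∈⁅y⁆⇒x≡y y x∈y)
... | inj₂ x∈xs = there (∈-toSet⁻ xs x∈xs)

toSet-unique : ∀ {n} {p : Subset n} xs → (∀ {x} → x ∈ xs → x ∈ˢ p) → (∀ {x} → x ∈ˢ p → x ∈ xs) → toSet xs ≡ p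
toSet-unique xs to from = ⊆-antisym (to ∘ ∈-toSet⁻ xs) (∈-toSet⁺ ∘ from)

∣p∪q∣≤∣p∣+∣q∣ : ∀ {n} (p q : Subset n) → ∣ p ∪ q ∣ ≤ ∣ p ∣ + ∣ q ∣
∣p∪q∣≤∣p∣+∣q∣ []            []            = z≤n
∣p∪q∣≤∣p∣+∣q∣ (outside ∷ p) (outside ∷ q) = ∣p∪q∣≤∣p∣+∣q∣ p q
∣p∪q∣≤∣p∣+∣q∣ (outside ∷ p) (inside ∷ q)  = ≤-trans (s≤s (∣p∪q∣≤∣p∣+∣q∣ p q)) (≤-reflexive (sym (+-suc ∣ p ∣ ∣ q ∣)))
∣p∪q∣≤∣p∣+∣q∣ (inside ∷ p)  (outside ∷ q) = s≤s (∣p∪q∣≤∣p∣+∣q∣ p q)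
∣p∪q∣≤∣p∣+∣q∣ (inside ∷ p)  (inside ∷ q)  = s≤s (≤-trans (∣p∪q∣≤∣p∣+∣q∣ p q) (+-monoʳ-≤ ∣ p ∣ (n≤1+n ∣ q ∣)))

∣⁅x⁆∪p∣ : ∀ {n} {x : Fin n} {p} → x ∉ˢ p → ∣ ⁅ x ⁆ ∪ p ∣ ≡ suc ∣ p ∣
∣⁅x⁆∪p∣ {x = zero}  {inside ∷ p}  x∉ = contradiction here x∉
∣⁅x⁆∪p∣ {x = zero}  {outside ∷ p} x∉ = cong (suc ∘ ∣_∣) (∪-identityˡ p)
∣⁅x⁆∪p∣ {x = suc x} {inside ∷ p}  x∉ = cong suc (∣⁅x⁆∪p∣ (x∉ ∘ there))
∣⁅x⁆∪p∣ {x = suc x} {outside ∷ p} x∉ = ∣⁅x⁆∪p∣ (x∉ ∘ there)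

∣toSet∣≤length : ∀ {n} (xs : List (Fin n)) → ∣ toSet xs ∣ ≤ length xs
∣toSet∣≤length {n} [] = ≤-reflexive (∣⊥∣≡0 n)
∣toSet∣≤length (x ∷ xs) = ≤-trans (∣p∪q∣≤∣p∣+∣q∣ ⁅ x ⁆ (toSet xs))
  (+-mono-≤ (≤-reflexive (∣⁅x⁆∣≡1 x)) (∣toSet∣≤length xs))

∣toSet∣≡length : ∀ {n} {xs : List (Fin n)} → Unique xs → ∣ toSet xs ∣ ≡ length xs
∣toSet∣≡length {n} []            = ∣⊥∣≡0 n
∣toSet∣≡length {xs = x ∷ xs} (x∉ ∷ uniq) = trans (∣⁅x⁆∪p∣ (All¬⇒¬Any x∉ ∘ ∈-toSet⁻ xs)) (cong suc (∣toSet∣≡length uniq))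

∣toSet-++∣ : ∀ {n} (xs ys : List (Fin n)) → ∣ toSet (xs ++ ys) ∣ ≤ ∣ toSet xs ∣ + length ys
∣toSet-++∣ xs ys = ≤-trans (≤-reflexive (cong ∣_∣ (toSet-++ xs)))
  (≤-trans (∣p∪q∣≤∣p∣+∣q∣ (toSet xs) (toSet ys)) (+-monoʳ-≤ ∣ toSet xs ∣ (∣toSet∣≤length ys)))
  where
  toSet-++ : ∀ xs → toSet (xs ++ ys) ≡ toSet xs ∪ toSet ys
  toSet-++ []       = sym (∪-identityˡ (toSet ys))
  toSet-++ (x ∷ xs) = trans (cong (⁅ x ⁆ ∪_) (toSet-++ xs)) (sym (∪-assoc ⁅ x ⁆ (toSet xs) (toSet ys)))

elems : ∀ {n} → Subset n → List (Fin n)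
elems {n} p = filter (_∈ˢ? p) (allFin n)

∈-elems⁺ : ∀ {n} {p : Subset n} {x} → x ∈ˢ p → x ∈ elems p
∈-elems⁺ {p = p} {x} x∈ = ∈-filter⁺ (_∈ˢ? p) (∈-allFin x) x∈

∈-elems⁻ : ∀ {n} (p : Subset n) {x} → x ∈ elems p → x ∈ˢ p
∈-elems⁻ {n} p x∈ = proj₂ (∈-filter⁻ (_∈ˢ? p) {xs = allFin n} x∈)

elems-unique : ∀ {n} (p : Subset n) → Unique (elems p)
elems-unique {n} p = Unique.filter⁺ (_∈ˢ? p) (Unique.allFin⁺ n)

length-elems : ∀ {n} (p : Subset n) → length (elems p) ≡ ∣ p ∣
length-elems p = trans (sym (∣toSet∣≡length (elems-unique p)))
  (cong ∣_∣ (toSet-unique (elems p) (∈-elems⁻ p) ∈-elems⁺))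

∑-vecs-All∈ : ∀ {n} (p : Subset n) s → ∑ (vecs n s) (λ v → 𝟙 (All.all? (_∈ˢ? p) (toList v))) ≡ ∣ p ∣ ^ s
∑-vecs-All∈     p zero    = refl
∑-vecs-All∈ {n} p (suc s) = begin
  ∑ (vecs n (suc s)) (λ v → 𝟙 (All.all? (_∈ˢ? p) (toList v)))
    ≡⟨ ∑-product _∷_ (allFin n) (vecs n s) _ ⟩
  ∑ (allFin n) (λ x → ∑ (vecs n s) (λ v → 𝟙 (All.all? (_∈ˢ? p) (x ∷ toList v))))
    ≡⟨ ∑-cong (allFin n) (λ x → trans
         (∑-cong (vecs n s) λ v → trans
           (𝟙-cong (All.all? (_∈ˢ? p) (x ∷ toList v)) ((x ∈ˢ? p) ×-dec All.all? (_∈ˢ? p) (toList v))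
           All.uncons (λ (x∈ , v⊆) → x∈ ∷ v⊆)) (𝟙-× (x ∈ˢ? p) (All.all? (_∈ˢ? p) (toList v))))
         (∑-*ˡ (vecs n s) (𝟙 (x ∈ˢ? p)) _)) ⟩
  ∑ (allFin n) (λ x → 𝟙 (x ∈ˢ? p) * ∑ (vecs n s) (λ v → 𝟙 (All.all? (_∈ˢ? p) (toList v))))
    ≡⟨ ∑-*ʳ (allFin n) _ _ ⟩
  ∑ (allFin n) (λ x → 𝟙 (x ∈ˢ? p)) * ∑ (vecs n s) (λ v → 𝟙 (All.all? (_∈ˢ? p) (toList v)))
    ≡⟨ cong₂ _*_ size (∑-vecs-All∈ p s) ⟩
  ∣ p ∣ * ∣ p ∣ ^ s ∎
  where
  open ≡-Reasoning
  size : ∑ (allFin n) (λ x → 𝟙 (x ∈ˢ? p)) ≡ ∣ p ∣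
  size = trans (∑-cong (allFin n) λ x → sym (*-identityʳ _)) (trans (sym (∑-filter (_∈ˢ? p) (allFin n) (λ _ → 1)))
    (trans (∑-const (elems p) 1) (trans (*-identityʳ _) (length-elems p))))

_≟ˢ_ : ∀ {n} → B.DecidableEquality (Subset n)
_≟ˢ_ = ≡-dec Bool._≟_

-- All entries of v lie in the set that `a ++ v` spans, which is a member of `L`; and an r-set
-- admits only r^s vectors of length s. The crude r^s replaces a factorial, which affects only the
-- constants.
orderings : ∀ {n r} (L : List (Subset n)) → (∀ {e} → e ∈ L → ∣ e ∣ ≡ r) → (a : List (Fin n)) (s : ℕ)
  {P : Vec (Fin n) s → Set} (P? : Decidable P) → (∀ v → P v → toSet (a ++ toList v) ∈ L) →
  ∑ (vecs n s) (λ v → 𝟙 (P? v)) ≤ length L * r ^ s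
orderings {n} {r} L size a s P? P⇒∈ = begin
  ∑ (vecs n s) (λ v → 𝟙 (P? v))
    ≤⟨ ∑-mono (vecs n s) (λ v → 𝟙-elim (P? v) λ Pv →
         ≤-trans (≤-reflexive (sym (𝟙-yes (within? v (toSet (a ++ toList v)))
             (All.tabulate (λ x∈ → ∈-toSet⁺ (∈-++⁺ʳ a x∈))))))
           (∑-∈ (λ e → 𝟙 (within? v e)) (P⇒∈ v Pv))) ⟩
  ∑ (vecs n s) (λ v → ∑ L (λ e → 𝟙 (within? v e)))
    ≡⟨ ∑-swap (vecs n s) L _ ⟩
  ∑ L (λ e → ∑ (vecs n s) (λ v → 𝟙 (within? v e)))
    ≤⟨ ∑-bound L (λ {e} e∈L → ≤-reflexive (trans (∑-vecs-All∈ e s) (cong (_^ s) (size e∈L)))) ⟩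
  length L * r ^ s ∎
  where
  open ≤-Reasoning
  within? : ∀ v (e : Subset n) → Dec (All (_∈ˢ e) (toList v))
  within? v e = All.all? (_∈ˢ? e) (toList v)

-- Images under an injection and the copy of G they form

module _ {m n : ℕ} (φ : Fin m → Fin n) where

  ∈-image⁺ : ∀ {S u} → u ∈ˢ S → φ u ∈ˢ image φ S
  ∈-image⁺ {S} {u} u∈S = lookup⇒[]= (φ u) _ (trans (lookup∘tabulate _ (φ u))
    (dec-true (any? λ w → (w ∈ˢ? S) ×-dec (φ w ≟ φ u)) (u , u∈S , refl)))

  ∈-image⁻ : ∀ {S v} → v ∈ˢ image φ S → ∃ λ u → u ∈ˢ S × φ u ≡ v
  ∈-image⁻ {S} {v} v∈ with any? (λ w → (w ∈ˢ? S) ×-dec (φ w ≟ v))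
    | trans (sym (lookup∘tabulate (λ v → does (any? λ w → (w ∈ˢ? S) ×-dec (φ w ≟ v))) v))
        ([]=⇒lookup v∈)
  ... | yes u | _ = u

  toSet-map : ∀ xs → toSet (map φ xs) ≡ image φ (toSet xs)
  toSet-map xs = toSet-unique (map φ xs)
    (λ v∈ → case ∈-map⁻ φ v∈ of λ where (u , u∈ , refl) → ∈-image⁺ (∈-toSet⁺ u∈))
    (λ v∈ → case ∈-image⁻ v∈ of λ where (u , u∈ , refl) → ∈-map⁺ φ (∈-toSet⁻ xs u∈))

  module _ (injective : ∀ {i j} → φ i ≡ φ j → i ≡ j) where

    image-injective : ∀ {S S′} → image φ S ≡ image φ S′ → S ≡ S′
    image-injective eq = ⊆-antisym (half eq) (half (sym eq))
      where
      half : ∀ {S S′} → image φ S ≡ image φ S′ → S ⊆ S′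
      half eq u∈ with ∈-image⁻ (subst (φ _ ∈ˢ_) eq (∈-image⁺ u∈))
      ... | u′ , u′∈ , φ≡ = subst (_∈ˢ _) (injective φ≡) u′∈

    ∣image∣ : ∀ S → ∣ image φ S ∣ ≡ ∣ S ∣
    ∣image∣ S = begin
      ∣ image φ S ∣
        ≡⟨ cong (∣_∣ ∘ image φ) (sym (toSet-unique (elems S) (∈-elems⁻ S) ∈-elems⁺)) ⟩
      ∣ image φ (toSet (elems S)) ∣ ≡⟨ cong ∣_∣ (sym (toSet-map (elems S))) ⟩
      ∣ toSet (map φ (elems S)) ∣   ≡⟨ ∣toSet∣≡length (Unique.map⁺ injective (elems-unique S)) ⟩
      length (map φ (elems S))      ≡⟨ Data.List.Properties.length-map φ (elems S) ⟩
      length (elems S)              ≡⟨ length-elems S ⟩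
      ∣ S ∣                         ∎
      where
      open ≡-Reasoning
      import Data.List.Properties

    module _ (G : Hypergraph m) (H : Hypergraph n)
      (edge : ∀ e → T (isEdge G e) → T (isEdge H (image φ e))) where

      imageEdge? : ∀ f → Dec (Any (λ e → T (isEdge G e) × image φ e ≡ f) (subsets m))
      imageEdge? f = Any.any? (λ e → T? (isEdge G e) ×-dec (image φ e ≟ˢ f)) (subsets m)

      preimage : ∀ {f} → T ⌊ imageEdge? f ⌋ → ∃ λ e → T (isEdge G e) × image φ e ≡ f
      preimage {f} t = case find (toWitness {a? = imageEdge? f} t) of λ (e , _ , e-edge , eq) → e , e-edge , eq

      copy : Subhypergraph H
      copy = record
        { vertices   = image φ ⊤
        ; isSubEdge  = λ f → ⌊ imageEdge? f ⌋
        ; ⊆-vertices = λ f t v∈f → case preimage t of λ where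
            (e , _ , refl) → case ∈-image⁻ v∈f of λ where (u , _ , refl) → ∈-image⁺ ∈⊤
        ; ⊆-edges    = λ f t → case preimage t of λ where (e , e-edge , refl) → edge e e-edge
        }

      copy-≅ : G ≅ copy
      copy-≅ = record
        { φ         = φ
        ; injective = injective
        ; onto      = λ v → mk⇔ (map₂ proj₂ ∘ ∈-image⁻) (λ where (u , refl) → ∈-image⁺ ∈⊤)
        ; edge⇔edge = λ e → mk⇔ (λ t → fromWitness (lose (∈-subsets e) (t , refl)))
            (λ t → case preimage t of λ (e′ , e′-edge , eq) → subst (T ∘ isEdge G) (image-injective eq) e′-edge)
        }

-- Hypergraphs

∈∈⇒2≤length : {X : Set} {x y : X} {xs : List X} → x ≢ y → x ∈ xs → y ∈ xs → 2 ≤ length xs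
∈∈⇒2≤length x≢y (here refl) (here refl)           = contradiction refl x≢y
∈∈⇒2≤length x≢y (here _)    (there {xs = _ ∷ _} _) = s≤s (s≤s z≤n)
∈∈⇒2≤length x≢y (there {xs = _ ∷ _} _) _           = s≤s (s≤s z≤n)

∈-edges′ : ∀ {n} (H : Hypergraph n) (e : E H) → e ∈ edges H
∈-edges′ H (e , t) with ∈-edges H e t
... | t′ , e∈ = subst (λ t → (e , t) ∈ edges H) (T-irrelevant t′ t) e∈

module _ {m : ℕ} (G : Hypergraph m) where

  edgeSets⊇ : Subset m → List (Subset m)
  edgeSets⊇ S = map proj₁ (filter (λ e → S ⊆? proj₁ e) (edges G))

  ∈-edgeSets⊇ : ∀ {S e} → S ⊆ e → T (isEdge G e) → e ∈ edgeSets⊇ S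
  ∈-edgeSets⊇ {S} S⊆e t = ∈-map⁺ proj₁ (∈-filter⁺ (λ e → S ⊆? proj₁ e) (∈-edges′ G (_ , t)) S⊆e)

  length-edgeSets⊇ : ∀ S → length (edgeSets⊇ S) ≤ Δ ∣ S ∣ G
  length-edgeSets⊇ S = ≤-trans (≤-reflexive (length-map proj₁ (filter (λ e → S ⊆? proj₁ e) (edges G)))) (degree≤Δ G S)

  -- Otherwise some ℓ + 1 common vertices would lie in two different edges and have degree at least
  -- 2.
  ∣e∩f∣≤ : ∀ {ℓ e f} → Δ (suc ℓ) G ≡ 1 → T (isEdge G e) → T (isEdge G f) → e ≢ f → ∣ e ∩ f ∣ ≤ ℓ
  ∣e∩f∣≤ {ℓ} {e} {f} Δ≡1 e-edge f-edge e≢f = ≮⇒≥ λ ℓ< → case shrink {j = suc ℓ} (e ∩ f) ℓ< of λ where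
    (S , S⊆e∩f , |S|) → <-irrefl refl (≤-trans
      (∈∈⇒2≤length e≢f (∈-edgeSets⊇ (p∩q⊆p e f ∘ S⊆e∩f) e-edge) (∈-edgeSets⊇ (p∩q⊆q e f ∘ S⊆e∩f) f-edge))
      (≤-trans (length-edgeSets⊇ S) (≤-reflexive (trans (cong (λ j → Δ j G) |S|) Δ≡1))))

-- Listing two edges with their common vertices first

module _ {m : ℕ} (e f : Subset m) where
  common rest-e rest-f : List (Fin m)
  common = elems (e ∩ f)
  rest-e = elems (e ∩ ∁ f)
  rest-f = elems (f ∩ ∁ e)

  toSet-split-e : toSet (common ++ rest-e) ≡ e
  toSet-split-e = toSet-unique (common ++ rest-e)
    (λ x∈ → case ∈-++⁻ common x∈ of λ where
      (inj₁ x∈) → proj₁ (x∈p∩q⁻ e f (∈-elems⁻ _ x∈))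
      (inj₂ x∈) → proj₁ (x∈p∩q⁻ e (∁ f) (∈-elems⁻ _ x∈)))
    (λ {x} x∈e → case x ∈ˢ? f of λ where
      (yes x∈f) → ∈-++⁺ˡ (∈-elems⁺ (x∈p∩q⁺ (x∈e , x∈f)))
      (no x∉f)  → ∈-++⁺ʳ common (∈-elems⁺ (x∈p∩q⁺ (x∈e , x∉p⇒x∈∁p x∉f))))

  toSet-split-f : toSet (common ++ rest-f) ≡ f
  toSet-split-f = toSet-unique (common ++ rest-f)
    (λ x∈ → case ∈-++⁻ common x∈ of λ where
      (inj₁ x∈) → proj₂ (x∈p∩q⁻ e f (∈-elems⁻ _ x∈))
      (inj₂ x∈) → proj₁ (x∈p∩q⁻ f (∁ e) (∈-elems⁻ _ x∈)))
    (λ {x} x∈f → case x ∈ˢ? e of λ where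
      (yes x∈e) → ∈-++⁺ˡ (∈-elems⁺ (x∈p∩q⁺ (x∈e , x∈f)))
      (no x∉e)  → ∈-++⁺ʳ common (∈-elems⁺ (x∈p∩q⁺ (x∈f , x∉p⇒x∈∁p x∉e))))

  disjoint-e : ∀ {x} → ¬ (x ∈ common × x ∈ rest-e)
  disjoint-e (x∈ , x∈e) = x∈∁p⇒x∉p (proj₂ (x∈p∩q⁻ e (∁ f) (∈-elems⁻ _ x∈e))) (proj₂ (x∈p∩q⁻ e f (∈-elems⁻ _ x∈)))

  disjoint-f : ∀ {x} → ¬ (x ∈ common × x ∈ rest-f)
  disjoint-f (x∈ , x∈f) = x∈∁p⇒x∉p (proj₂ (x∈p∩q⁻ f (∁ e) (∈-elems⁻ _ x∈f))) (proj₁ (x∈p∩q⁻ e f (∈-elems⁻ _ x∈)))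

  length-rest : ∀ {g} (d : Subset m) → (∀ {x} → ¬ (x ∈ common × x ∈ elems d)) →
                toSet (common ++ elems d) ≡ g → length (elems d) ≡ ∣ g ∣ ∸ length common
  length-rest {g} d disjoint eq = begin
    length (elems d)
      ≡⟨ sym (m+n∸m≡n (length common) (length (elems d))) ⟩
    length common + length (elems d) ∸ length common
      ≡⟨ cong (_∸ length common) (sym (length-++ common)) ⟩
    length (common ++ elems d) ∸ length common
      ≡⟨ cong (_∸ length common) (sym (∣toSet∣≡length
                                                             (Unique.++⁺ (elems-unique (e ∩ f)) (elems-unique d) disjoint))) ⟩
    ∣ toSet (common ++ elems d) ∣ ∸ length common       ≡⟨ cong (λ h → ∣ h ∣ ∸ length common) eq ⟩
    ∣ g ∣ ∸ length common                               ∎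
    where open ≡-Reasoning

  unique-parts : Unique (common ++ rest-e ++ rest-f)
  unique-parts = Unique.++⁺ (elems-unique _)
    (Unique.++⁺ (elems-unique _) (elems-unique _)
      (λ (x∈e , x∈f) → x∈∁p⇒x∉p (proj₂ (x∈p∩q⁻ f (∁ e) (∈-elems⁻ _ x∈f))) (proj₁ (x∈p∩q⁻ e (∁ f) (∈-elems⁻ _ x∈e)))))
    (λ (x∈ , y∈) → case ∈-++⁻ rest-e y∈ of λ where
      (inj₁ x∈e) → disjoint-e (x∈ , x∈e)
      (inj₂ x∈f) → disjoint-f (x∈ , x∈f))

-- From bounded colourings to colour-separating injections

-- The common form of both boundedness hypotheses. Only an upper bound is wanted, so `L` may contain
-- more than the edges required: every edge of the colour in the global case, those through one
-- vertex of `a` in the local case.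
Mates : {n r : ℕ} → Coloring (K n r) → ℕ → ℕ → Set
Mates {n} {r} c k j = ∀ a → length a ≡ j → (e : E (K n r)) →
  ∃ λ (L : List (E (K n r))) → length L ≤ k × (∀ {f} → toSet a ⊆ proj₁ f → c f ≡ c e → f ∈ L)

Separates : {m n r : ℕ} → Hypergraph m → Coloring (K n r) → List ℕ → (Fin m → Fin n) → Set
Separates G c js φ = ∀ {e f} → T (isEdge G e) → T (isEdge G f) → ∣ e ∩ f ∣ ∈ js →
  ∀ p q → c (image φ e , p) ≢ c (image φ f , q)

module _
  {m n r ℓ : ℕ} .{{_ : NonZero n}} .{{_ : NonZero r}} (m≤n : m ≤ n) (ℓ≤r : ℓ ≤ r)
  (G : Hypergraph m) (uniform : Uniform r G) (c : Coloring (K n r))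
  (js : List ℕ) (js≤ℓ : ∀ {j} → j ∈ js → j ≤ ℓ) (|js|≤r : length js ≤ r) (k : ℕ)
  (mates : ∀ {j} → j ∈ js → Mates c k j)
  (small : sizeConstant r * (Δ 1 G * r ^ r * (Δ ℓ G * r ^ r) * (k * r ^ r)) ≤ n ^ (r ∸ ℓ))
  where

  Ordered : List (Fin m) → Set
  Ordered u = T (isEdge G (toSet u))

  SameColour : List (Fin n) → List (Fin n) → Set
  SameColour u v = ∃ λ p → ∃ λ q → c (toSet u , p) ≡ c (toSet v , q)

  sameColour? : B.Decidable SameColour
  sameColour? u v with T? (isEdge (K n r) (toSet u)) | T? (isEdge (K n r) (toSet v))
  ... | no ¬p | _     = no (¬p ∘ proj₁)
  ... | yes _ | no ¬q = no (¬q ∘ proj₁ ∘ proj₂)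
  ... | yes p | yes q with c (toSet u , p) ℕ.≟ c (toSet v , q)
  ...   | yes eq = yes (p , q , eq)
  ...   | no neq = no λ (p′ , q′ , eq) → neq (trans (cong (λ t → c (toSet u , t)) (T-irrelevant p p′))
                     (trans eq (cong (λ t → c (toSet v , t)) (T-irrelevant q′ q))))

  edgeSets⊇-size : ∀ S {e} → e ∈ edgeSets⊇ G S → ∣ e ∣ ≡ r
  edgeSets⊇-size S e∈ = case ∈-map⁻ proj₁ e∈ of λ where ((e , t) , _ , refl) → uniform e t

  K-size : (L : List (E (K n r))) → ∀ {e} → e ∈ map proj₁ L → ∣ e ∣ ≡ r
  K-size L e∈ = case ∈-map⁻ proj₁ e∈ of λ where ((e , t) , _ , refl) → toWitness t

  ⊆-++ : ∀ {N} (a b : List (Fin N)) → toSet a ⊆ toSet (a ++ b)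
  ⊆-++ a b x∈ = ∈-toSet⁺ (∈-++⁺ˡ (∈-toSet⁻ a x∈))

  open ≤-Reasoning

  ordered∋ : ∀ x → ∑ (vecs m r) (λ v → 𝟙 (x ∈? toList v) * 𝟙 (T? (isEdge G (toSet (toList v))))) ≤ Δ 1 G * r ^ r
  ordered∋ x = begin
    ∑ (vecs m r) (λ v → 𝟙 (x ∈? toList v) * 𝟙 (T? (isEdge G (toSet (toList v)))))
      ≡⟨ ∑-cong (vecs m r) (λ v → sym (𝟙-× (x ∈? toList v) (T? (isEdge G (toSet (toList v)))))) ⟩
    ∑ (vecs m r) (λ v → 𝟙 ((x ∈? toList v) ×-dec T? (isEdge G (toSet (toList v)))))
      ≤⟨ orderings (edgeSets⊇ G ⁅ x ⁆) (edgeSets⊇-size ⁅ x ⁆) [] r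
           (λ v → (x ∈? toList v) ×-dec T? (isEdge G (toSet (toList v))))
           (λ v (x∈ , t) → ∈-edgeSets⊇ G (λ y∈ → subst (_∈ˢ toSet (toList v)) (sym (x∈⁅y⁆⇒x≡y x y∈)) (∈-toSet⁺ x∈)) t) ⟩
    length (edgeSets⊇ G ⁅ x ⁆) * r ^ r
      ≤⟨ *-monoˡ-≤ (r ^ r) (length-edgeSets⊇ G ⁅ x ⁆) ⟩
    Δ ∣ ⁅ x ⁆ ∣ G * r ^ r
      ≡⟨ cong (λ j → Δ j G * r ^ r) (∣⁅x⁆∣≡1 x) ⟩
    Δ 1 G * r ^ r ∎

  -- If a repeats a vertex, then a ++ c has fewer than r vertices and is not an edge.
  ordered⊇ : ∀ a → length a ≡ ℓ → ∑ (vecs m (r ∸ ℓ)) (λ v → 𝟙 (T? (isEdge G (toSet (a ++ toList v))))) ≤ Δ ℓ G * r ^ r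
  ordered⊇ a |a|≡ℓ with ∣ toSet a ∣ ℕ.≟ ℓ
  ... | yes eq = begin
    ∑ (vecs m (r ∸ ℓ)) (λ v → 𝟙 (T? (isEdge G (toSet (a ++ toList v)))))
      ≤⟨ orderings (edgeSets⊇ G (toSet a)) (edgeSets⊇-size (toSet a)) a (r ∸ ℓ)
           (λ v → T? (isEdge G (toSet (a ++ toList v))))
           (λ v t → ∈-edgeSets⊇ G (⊆-++ a (toList v)) t) ⟩
    length (edgeSets⊇ G (toSet a)) * r ^ (r ∸ ℓ)
      ≤⟨ *-mono-≤ (≤-trans (length-edgeSets⊇ G (toSet a)) (≤-reflexive (cong (λ j → Δ j G) eq)))
           (^-monoʳ-≤ r (m∸n≤m r ℓ)) ⟩
    Δ ℓ G * r ^ r ∎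
  ... | no neq = ≤-trans (orderings {r = r} [] (λ ()) a (r ∸ ℓ) (λ v → T? (isEdge G (toSet (a ++ toList v))))
    (λ v t → contradiction (≤-antisym (≤-trans (∣toSet∣≤length a) (≤-reflexive |a|≡ℓ)) (large v t)) neq)) z≤n
    where
    large : ∀ v → T (isEdge G (toSet (a ++ toList v))) → ℓ ≤ ∣ toSet a ∣
    large v t = +-cancelʳ-≤ (r ∸ ℓ) ℓ ∣ toSet a ∣ (begin
      ℓ + (r ∸ ℓ)                           ≡⟨ m+[n∸m]≡n ℓ≤r ⟩
      r                                     ≡⟨ sym (uniform _ t) ⟩
      ∣ toSet (a ++ toList v) ∣             ≤⟨ ∣toSet-++∣ a (toList v) ⟩
      ∣ toSet a ∣ + length (toList v)       ≡⟨ cong (∣ toSet a ∣ +_) (length-toList v) ⟩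
      ∣ toSet a ∣ + (r ∸ ℓ)                 ∎)

  orderedMates : ∀ {j} → j ∈ js → ∀ a b → length a ≡ j → length b ≡ r ∸ j →
    ∑ (vecs n (r ∸ j)) (λ v → 𝟙 (sameColour? (a ++ b) (a ++ toList v))) ≤ k * r ^ r
  orderedMates {j} j∈js a b |a| |b| = go (T? (isEdge (K n r) (toSet (a ++ b))))
    where
    bound : (L : List (E (K n r))) → length L ≤ k →
            (∀ v → SameColour (a ++ b) (a ++ toList v) → toSet (a ++ toList v) ∈ map proj₁ L) →
            ∑ (vecs n (r ∸ j)) (λ v → 𝟙 (sameColour? (a ++ b) (a ++ toList v))) ≤ k * r ^ r
    bound L |L|≤k L∋ = ≤-trans
      (orderings (map proj₁ L) (K-size L) a (r ∸ j) (λ v → sameColour? (a ++ b) (a ++ toList v)) L∋)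
      (*-mono-≤ (≤-trans (≤-reflexive (length-map proj₁ L)) |L|≤k) (^-monoʳ-≤ r (m∸n≤m r j)))
    go : Dec (T (isEdge (K n r) (toSet (a ++ b)))) → _
    -- `Mates` needs an edge to name the colour. If `a ++ b` is not an edge of the host, it has no
    -- colour, and every term of the sum vanishes.
    go (no ¬p) = bound [] z≤n (λ v s → contradiction (proj₁ s) ¬p)
    go (yes p) with mates j∈js a |a| (toSet (a ++ b) , p)
    ... | L , |L|≤k , L∋ = bound L |L|≤k λ v (p′ , q , eq) →
      ∈-map⁺ proj₁ (L∋ {toSet (a ++ toList v) , q} (⊆-++ a (toList v))
        (trans (sym eq) (cong (λ t → c (toSet (a ++ b) , t)) (T-irrelevant p′ p))))

  conflictFree : ∃ λ (φ : Fin m → Fin n) → (∀ {i j} → φ i ≡ φ j → i ≡ j) × Separates G c js φ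
  conflictFree = map₂ (λ {φ} (injective , proper) → injective , avoid φ injective proper) embedding
    where
    open Embedding m n r ℓ m≤n ℓ≤r (λ u → T? (isEdge G (toSet u))) sameColour?
      (λ (p , q , eq) → q , p , sym eq) js js≤ℓ |js|≤r
      (Δ 1 G * r ^ r) (Δ ℓ G * r ^ r) (k * r ^ r) ordered∋ ordered⊇ orderedMates small using (embedding)
    avoid : ∀ (φ : Fin m → Fin n) (injective : ∀ {i j} → φ i ≡ φ j → i ≡ j) →
      (∀ {j} → j ∈ js → ∀ a b b′ → length a ≡ j → length b ≡ r ∸ j → length b′ ≡ r ∸ j →
       Ordered (a ++ b) → Ordered (a ++ b′) → Unique (map φ (a ++ b ++ b′)) →
       ¬ SameColour (map φ (a ++ b)) (map φ (a ++ b′))) →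
      Separates G c js φ
    avoid φ injective proper {e} {f} e-edge f-edge ∩∈js p q eq =
      proper ∩∈js (common e f) (rest-e e f) (rest-f e f) (length-elems (e ∩ f))
        (lengths e (e ∩ ∁ f) e-edge (disjoint-e e f) (toSet-split-e e f))
        (lengths f (f ∩ ∁ e) f-edge (disjoint-f e f) (toSet-split-f e f))
        (subst (T ∘ isEdge G) (sym (toSet-split-e e f)) e-edge)
        (subst (T ∘ isEdge G) (sym (toSet-split-f e f)) f-edge)
        (Unique.map⁺ injective (unique-parts e f))
        (same (map φ (common e f ++ rest-e e f)) (map φ (common e f ++ rest-f e f))
          (onSet (common e f ++ rest-e e f) (toSet-split-e e f))
          (onSet (common e f ++ rest-f e f) (toSet-split-f e f)) p q eq)
      where
      lengths : ∀ g d → T (isEdge G g) → (∀ {x} → ¬ (x ∈ common e f × x ∈ elems d)) →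
                toSet (common e f ++ elems d) ≡ g → length (elems d) ≡ r ∸ ∣ e ∩ f ∣
      lengths g d g-edge disjoint split = trans (length-rest e f d disjoint split)
        (cong₂ _∸_ (uniform g g-edge) (length-elems (e ∩ f)))
      onSet : ∀ xs {g} → toSet xs ≡ g → toSet (map φ xs) ≡ image φ g
      onSet xs split = trans (toSet-map φ xs) (cong (image φ) split)
      -- With the two sets generalised to variables, matching on `refl` transports the edge proofs
      -- `p` and `q` inside the colours.
      same : ∀ u v {e′ f′} → toSet u ≡ e′ → toSet v ≡ f′ → ∀ p q → c (e′ , p) ≡ c (f′ , q) → SameColour u v
      same u v refl refl p q eq = p , q , eq

-- Rational bounds and the constants

open import Data.Integer using (+_)

-- Unnormalised rationals undo the cancellation of common factors built into `_/_`; there the order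
-- is cross-multiplication of integers, which is the claim once the units are removed.
≤-quotient⇒*≤ : ∀ x N Z d .{{_ : NonZero Z}} .{{_ : NonZero d}} →
                + x / 1 ≤ℚ + 1 / Z *ℚ (+ N / d) → x * (Z * d) ≤ N
≤-quotient⇒*≤ x N Z@(suc Z-1) d@(suc d-1) x≤ = unwrap (begin
  mkℚᵘ (+ x) 0                        ≃⟨ ℚᵘ.≃-sym (toℚᵘ-fromℚᵘ (mkℚᵘ (+ x) 0)) ⟩
  toℚᵘ (+ x / 1)                      ≤⟨ toℚᵘ-mono-≤ x≤ ⟩
  toℚᵘ (+ 1 / Z *ℚ (+ N / d))         ≃⟨ toℚᵘ-homo-* (+ 1 / Z) (+ N / d) ⟩
  toℚᵘ (+ 1 / Z) ℚᵘ.* toℚᵘ (+ N / d)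
    ≃⟨ ℚᵘ.*-cong (toℚᵘ-fromℚᵘ (mkℚᵘ (+ 1) Z-1)) (toℚᵘ-fromℚᵘ (mkℚᵘ (+ N) d-1)) ⟩
  mkℚᵘ (+ 1) Z-1 ℚᵘ.* mkℚᵘ (+ N) d-1  ∎)
  where
  open ℚᵘ.≤-Reasoning
  unwrap : mkℚᵘ (+ x) 0 ℚᵘ.≤ mkℚᵘ (+ 1) Z-1 ℚᵘ.* mkℚᵘ (+ N) d-1 → x * (Z * d) ≤ N
  unwrap (*≤* le) = ℤ.drop‿+≤+ (subst₂ ℤ._≤_ (sym (ℤ.pos-* x (Z * d))) (trans (ℤ.*-identityʳ _) (ℤ.*-identityˡ (+ N))) le)

-- The three factors `r ^ r` pay for ordering edges in the three counts: edges through a vertex,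
-- edges containing an ℓ-set, and edges of a given colour.
boundConstant : ℕ → ℕ
boundConstant r = sizeConstant r * (r ^ r * (r ^ r * r ^ r))

boundConstant≢0 : ∀ r .{{_ : NonZero r}} → NonZero (boundConstant r)
boundConstant≢0 r = m*n≢0 (sizeConstant r) _ {{sizeConstant≢0}}
  {{m*n≢0 (r ^ r) _ {{r^r}} {{m*n≢0 (r ^ r) (r ^ r) {{r^r}} {{r^r}}}}}}
  where
  r^r : NonZero (r ^ r)
  r^r = m^n≢0 r r
  r+r : NonZero (r + r)
  r+r = >-nonZero (≤-trans (>-nonZero⁻¹ r) (m≤m+n r r))
  sizeConstant≢0 : NonZero (sizeConstant r)
  sizeConstant≢0 = m*n≢0 (8 * r * suc r) _ {{m*n≢0 (8 * r) (suc r) {{m*n≢0 8 r}}}}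
    {{m*n≢0 (r + r) _ {{r+r}} {{m^n≢0 (r + r) (r + r) {{r+r}}}}}}

-- Proper and rainbow copies

module BoundedColourings
  {m n r ℓ : ℕ} .{{_ : NonZero n}} .{{_ : NonZero r}} (m≤n : m ≤ n) (ℓ<r : ℓ < r)
  (G : Hypergraph m) (uniform : Uniform r G) (Δ≡1 : Δ (suc ℓ) G ≡ 1) where

  private instance
    Z≢0 : NonZero (boundConstant r)
    Z≢0 = boundConstant≢0 r
    ΔΔ≢0 : NonZero (Δ 1 G * Δ ℓ G)
    ΔΔ≢0 = ΔΔ-nonZero G Δ≡1
    ZΔΔ≢0 : NonZero (boundConstant r * (Δ 1 G * Δ ℓ G))
    ZΔΔ≢0 = m*n≢0 (boundConstant r) (Δ 1 G * Δ ℓ G)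

  -- `k` is the integer part of the rational `bound`. Counts of edges are integers, so nothing is
  -- lost, and the size condition becomes the inequality between a rounded quotient times its
  -- divisor and `N`.
  N k : ℕ
  N = n ^ (r ∸ ℓ)
  k = N ℕ./ (boundConstant r * (Δ 1 G * Δ ℓ G))

  bound : ℚ
  bound = + 1 / boundConstant r *ℚ (+ N / (Δ 1 G * Δ ℓ G))

  ≤bound⇒≤k : ∀ x → + x / 1 ≤ℚ bound → x ≤ k
  ≤bound⇒≤k x x≤ = begin
    x                                                        ≡⟨ sym (m*n/n≡m x (boundConstant r * (Δ 1 G * Δ ℓ G))) ⟩
    x * (boundConstant r * (Δ 1 G * Δ ℓ G)) ℕ./ (boundConstant r * (Δ 1 G * Δ ℓ G))
      ≤⟨ /-monoˡ-≤ (boundConstant r * (Δ 1 G * Δ ℓ G)) (≤-quotient⇒*≤ x N (boundConstant r) (Δ 1 G * Δ ℓ G) x≤) ⟩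
    k                                                        ∎
    where open ≤-Reasoning

  small : sizeConstant r * (Δ 1 G * r ^ r * (Δ ℓ G * r ^ r) * (k * r ^ r)) ≤ N
  small = begin
    sizeConstant r * (Δ 1 G * r ^ r * (Δ ℓ G * r ^ r) * (k * r ^ r))
      ≡⟨ rearrange (sizeConstant r) (Δ 1 G) (Δ ℓ G) (r ^ r) k ⟩
    k * (sizeConstant r * (r ^ r * (r ^ r * r ^ r)) * (Δ 1 G * Δ ℓ G))
      ≤⟨ m/n*n≤m N (boundConstant r * (Δ 1 G * Δ ℓ G)) ⟩
    N ∎
    where
    open ≤-Reasoning
    rearrange : ∀ s a b w k → s * (a * w * (b * w) * (k * w)) ≡ k * (s * (w * (w * w)) * (a * b))
    rearrange = solve 5 (λ s a b w k → s :* (a :* w :* (b :* w) :* (k :* w))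
      := k :* (s :* (w :* (w :* w)) :* (a :* b))) refl
      where open +-*-Solver

  ∩≤ℓ : ∀ {e f} → T (isEdge G e) → T (isEdge G f) → e ≢ f → ∣ e ∩ f ∣ ≤ ℓ
  ∩≤ℓ = ∣e∩f∣≤ G Δ≡1

  module _ (φ : Fin m → Fin n) (injective : ∀ {i j} → φ i ≡ φ j → i ≡ j) where

    image-edge : ∀ e → T (isEdge G e) → T (isEdge (K n r) (image φ e))
    image-edge e t = fromWitness (trans (∣image∣ φ injective e) (uniform e t))

    G-copy : Subhypergraph (K n r)
    G-copy = copy φ injective G (K n r) image-edge

    G-copy-≅ : G ≅ G-copy
    G-copy-≅ = copy-≅ φ injective G (K n r) image-edge

    image-∩ : ∀ {e f} → Nonempty (image φ e ∩ image φ f) → 1 ≤ ∣ e ∩ f ∣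
    image-∩ {e} {f} (v , v∈) with x∈p∩q⁻ (image φ e) (image φ f) v∈
    ... | v∈e , v∈f with ∈-image⁻ φ v∈e | ∈-image⁻ φ v∈f
    ... | u , u∈e , φu≡v | u′ , u′∈f , φu′≡v =
      subst (_≤ ∣ e ∩ f ∣) (∣⁅x⁆∣≡1 u) (p⊆q⇒∣p∣≤∣q∣ λ w∈ → subst (_∈ˢ (e ∩ f)) (sym (x∈⁅y⁆⇒x≡y u w∈))
        (x∈p∩q⁺ (u∈e , subst (_∈ˢ f) (injective (trans φu′≡v (sym φu≡v))) u′∈f)))

    image-≢ : ∀ {e f : Subset m} → image φ e ≢ image φ f → e ≢ f
    image-≢ e≢f refl = e≢f refl

  locally⇒proper : (c : Coloring (K n r)) → LocallyBounded (K n r) bound c → G -proper c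
  locally⇒proper c bounded = case
    conflictFree m≤n (<⇒≤ ℓ<r) G uniform c js js≤ℓ |js|≤r k mates small of λ where
      (φ , injective , avoid) → G-copy φ injective , G-copy-≅ φ injective , proper φ injective avoid
    where
    js : List ℕ
    js = map suc (upTo ℓ)
    js≤ℓ : ∀ {j} → j ∈ js → j ≤ ℓ
    js≤ℓ j∈ = case ∈-map⁻ suc j∈ of λ where (i , i∈ , refl) → ∈-upTo⁻ i∈
    |js|≤r : length js ≤ r
    |js|≤r = ≤-trans (≤-reflexive (trans (length-map suc (upTo ℓ)) (length-upTo ℓ))) (<⇒≤ ℓ<r)
    mates : ∀ {j} → j ∈ js → Mates c k j
    -- An empty common part would mean j = 0, which `map suc` excludes; a nonempty one supplies the
    -- vertex `x` at which the local bound is applied.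
    mates j∈ []      refl e = case ∈-map⁻ suc j∈ of λ ()
    mates _  (x ∷ a) _    e = filter mate? (edges (K n r)) , ≤bound⇒≤k _ (bounded x (c e)) ,
      λ {f} a⊆f eq → ∈-filter⁺ mate? (∈-edges′ (K n r) f) (a⊆f (∈-toSet⁺ {xs = x ∷ a} (here refl)) , eq)
      where
      mate? : ∀ f → Dec (x ∈ˢ proj₁ f × c f ≡ c e)
      mate? f = (x ∈ˢ? proj₁ f) ×-dec (c f ℕ.≟ c e)
    proper : ∀ φ (injective : ∀ {i j} → φ i ≡ φ j → i ≡ j) →
      Separates G c js φ →
      ProperlyColored c (G-copy φ injective)
    proper φ injective avoid (e , s) (f , t) e≢f meet =
      onImages (preimage φ injective G (K n r) (image-edge φ injective) s)
               (preimage φ injective G (K n r) (image-edge φ injective) t) e≢f meet _ _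
      where
      in-js : ∀ {j} → 1 ≤ j → j ≤ ℓ → j ∈ js
      in-js (s≤s z≤n) j≤ℓ = ∈-map⁺ suc (∈-upTo⁺ j≤ℓ)
      -- Stated for arbitrary sets that are images, so that `refl` can replace them by `image φ e₀`
      -- and `image φ f₀` under the dependent edge proofs.
      onImages : ∀ {e f} → (∃ λ e₀ → T (isEdge G e₀) × image φ e₀ ≡ e) →
                 (∃ λ f₀ → T (isEdge G f₀) × image φ f₀ ≡ f) →
                 e ≢ f → Nonempty (e ∩ f) → ∀ p q → c (e , p) ≢ c (f , q)
      onImages (e₀ , e-edge , refl) (f₀ , f-edge , refl) e≢f meet =
        avoid e-edge f-edge (in-js (image-∩ φ injective meet) (∩≤ℓ e-edge f-edge (image-≢ φ injective e≢f)))

  globally⇒rainbow : (c : Coloring (K n r)) → GloballyBounded (K n r) bound c → G -rainbow c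
  globally⇒rainbow c bounded = case
    conflictFree m≤n (<⇒≤ ℓ<r) G uniform c js js≤ℓ |js|≤r k mates small of λ where
      (φ , injective , avoid) → G-copy φ injective , G-copy-≅ φ injective , rainbow φ injective avoid
    where
    js : List ℕ
    -- Disjoint edges must differ in colour as well, so j = 0 joins the list. It now has ℓ + 1
    -- entries, and this is at most r exactly because ℓ < r.
    js = upTo (suc ℓ)
    js≤ℓ : ∀ {j} → j ∈ js → j ≤ ℓ
    js≤ℓ j∈ = ≤-pred (∈-upTo⁻ j∈)
    |js|≤r : length js ≤ r
    |js|≤r = ≤-trans (≤-reflexive (length-upTo (suc ℓ))) ℓ<r
    mates : ∀ {j} → j ∈ js → Mates c k j
    mates _ _ _ e = filter (λ f → c f ℕ.≟ c e) (edges (K n r)) , ≤bound⇒≤k _ (bounded (c e)) ,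
      λ {f} _ eq → ∈-filter⁺ (λ f → c f ℕ.≟ c e) (∈-edges′ (K n r) f) eq
    rainbow : ∀ φ (injective : ∀ {i j} → φ i ≡ φ j → i ≡ j) →
      Separates G c js φ →
      Rainbow c (G-copy φ injective)
    rainbow φ injective avoid (e , s) (f , t) e≢f =
      onImages (preimage φ injective G (K n r) (image-edge φ injective) s)
               (preimage φ injective G (K n r) (image-edge φ injective) t) e≢f _ _
      where
      onImages : ∀ {e f} → (∃ λ e₀ → T (isEdge G e₀) × image φ e₀ ≡ e) →
                 (∃ λ f₀ → T (isEdge G f₀) × image φ f₀ ≡ f) →
                 e ≢ f → ∀ p q → c (e , p) ≢ c (f , q)
      onImages (e₀ , e-edge , refl) (f₀ , f-edge , refl) e≢f =
        avoid e-edge f-edge (∈-upTo⁺ (s≤s (∩≤ℓ e-edge f-edge (image-≢ φ injective e≢f))))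

theorem1p9 : ∀ (r ℓ : ℕ) → 2 ≤ r → 1 ≤ ℓ → ℓ < r →
    ∃ λ (c₁ : ℚ) → ∃ λ (c₂ : ℚ) → 0ℚ <ℚ c₁ × 0ℚ <ℚ c₂ ×
    (∀ (n : ℕ) → 1 ≤ n →
    ∀ (m : ℕ) → m ≤ n →
    ∀ (G : Hypergraph m) → Uniform r G → (Δ≡1 : Δ (suc ℓ) G ≡ 1) →
    let quotient = _/_ (+ (n ^ (r ∸ ℓ))) (Δ 1 G * Δ ℓ G) {{ΔΔ-nonZero G Δ≡1}} in
    (∀ (c : Coloring (K n r)) →
    LocallyBounded (K n r) (c₁ *ℚ quotient) c → G -proper c)
    ×
    (∀ (c : Coloring (K n r)) →
    GloballyBounded (K n r) (c₂ *ℚ quotient) c → G -rainbow c))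
-- One constant serves both parts, since the two kinds of bound enter the argument through `Mates`
-- with the same `k`.
theorem1p9 r ℓ 2≤r _ ℓ<r = + 1 / boundConstant r , + 1 / boundConstant r , positive , positive ,
  λ n 1≤n m m≤n G uniform Δ≡1 →
    let open BoundedColourings {{>-nonZero 1≤n}} m≤n ℓ<r G uniform Δ≡1
    in locally⇒proper , globally⇒rainbow
  where
  instance
    r≢0 : NonZero r
    r≢0 = >-nonZero (<⇒≤ 2≤r)
    Z≢0 : NonZero (boundConstant r)
    Z≢0 = boundConstant≢0 r
  positive : 0ℚ <ℚ + 1 / boundConstant r
  positive = positive⁻¹ (+ 1 / boundConstant r) {{normalize-pos 1 (boundConstant r)}}
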